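{- Let $G$ be a finite simple undirected connected graph, and let $c:V(G)\to \mathbb{R}_{>0}$ and $\kappa:V(G)\to \mathbb{Z}$ be functions such that $0\leq \kappa(u)\leq d_G(u)$ for every vertex $u$ of $G$. Then $$\alpha(G,c,\kappa) = \sum_{u\in V(G)} \frac{c(u)(\kappa(u)+1)}{d_G(u)+1}$$ holds if and only if either (i) $\kappa(u)=d_G(u)$ for every vertex $u$ of $G$, or (ii) $G$ is a clique (complete graph) and both $c$ and $\kappa$ are constant on $V(G)$.
   Context: $d_G(u)$ denotes the degree of $u$ in $G$, and $[n]=\{1,\dots,n\}$. For a set $I\subseteq V(G)$, its $c$-weight is $c(I)=\sum_{u\in I}c(u)$. A set $I\subseteq V(G)$ is called $\kappa$-degenerate in $G$ if there is a linear ordering $u_1,\ldots,u_k$ of the vertices of $I$ such that for every $i\in[k]$, $u_i$ has at most $\kappa(u_i)$ neighbors in $\{u_j: j\in[i-1]\}$. $\alpha(G,c,\kappa)$ denotes the maximum $c$-weight of a $\kappa$-degenerate set of vertices of $G$. (It is known that always $\alpha(G,c,\kappa)\geq \sum_{u\in V(G)} \frac{c(u)(\kappa(u)+1)}{d_G(u)+1}$.) -}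

module Defs where

open import Algebra.Bundles using (CommutativeRing)
open import Algebra.Bundles.Raw using (RawMonoid)
import Algebra.Properties.AbelianGroup as AbelianGroupProperties
import Algebra.Properties.CommutativeSemigroup as CommutativeSemigroupProperties
import Algebra.Properties.Ring as RingProperties
open import Data.Bool.Base using (if_then_else_)
open import Data.Fin.Base as Fin using (Fin)
import Data.Fin.Properties as Fin
open import Data.Fin.Subset using (Subset; inside; outside; _∈_; _∩_; ∣_∣)
open import Data.Fin.Subset.Properties using (_∈?_)
open import Data.Integer.Base as ℤ using (ℤ; +_)
import Data.Integer.Properties as ℤ
open import Data.List.Base as List using (List; _++_; filter; foldr)
open import Data.Nat.Base as ℕ using (ℕ; zero; suc; s≤s)
import Data.Nat.Properties as ℕ
open import Data.Product.Base using (∃; _×_; _,_)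
open import Data.Rational.Base as ℚ using (ℚ; 0ℚ; 1ℚ; ½)
import Data.Rational.Properties as ℚ
open import Data.Sum.Base using (inj₁; inj₂)
open import Data.Vec.Base using (Vec; []; _∷_; lookup; tabulate)
open import Function.Base using (_∘_)
open import Function.Bundles using (_⇔_; mk⇔; Equivalence)
open import Function.Definitions using (Injective)
open import Level using (0ℓ)
open import Relation.Binary.Construct.Closure.ReflexiveTransitive using (Star)
import Relation.Binary.Definitions as B
open import Relation.Binary.PropositionalEquality using (_≡_; _≢_; sym; trans; cong; cong₂; subst)
open import Relation.Nullary using (¬_; Dec; does)
open import Relation.Nullary.Decidable using (map′; _×-dec_; _→-dec_)
open import Relation.Unary using (Pred; Decidable)

------------------------------------------------------------------------
-- Real numbers: Cauchy sequences of rationals, compared up to _≈ℝ_.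

Eventually : Pred ℕ 0ℓ → Set
Eventually P = ∃ λ N → ∀ m → N ℕ.≤ m → P m

IsCauchy : (ℕ → ℚ) → Set
IsCauchy x = ∀ ε → 0ℚ ℚ.< ε →
  ∃ λ N → ∀ m n → N ℕ.≤ m → N ℕ.≤ n → ℚ.∣ x m ℚ.- x n ∣ ℚ.< ε

record ℝ : Set where
  constructor mkℝ
  field
    seq    : ℕ → ℚ
    cauchy : IsCauchy seq

open ℝ public

infix 4 _≈ℝ_ _<ℝ_

_≈ℝ_ : ℝ → ℝ → Set
x ≈ℝ y = ∀ ε → 0ℚ ℚ.< ε → Eventually λ m → ℚ.∣ seq x m ℚ.- seq y m ∣ ℚ.< ε

_<ℝ_ : ℝ → ℝ → Set
x <ℝ y = ∃ λ ε → 0ℚ ℚ.< ε × Eventually λ m → seq x m ℚ.+ ε ℚ.≤ seq y m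

private
  module ℚ-+ = AbelianGroupProperties ℚ.+-0-abelianGroup
  module ℚ-+ₛ = CommutativeSemigroupProperties
    (CommutativeRing.+-commutativeSemigroup ℚ.+-*-commutativeRing)
  module ℚ-* = RingProperties ℚ.+-*-ring

  half : ∀ ε → 0ℚ ℚ.< ε → 0ℚ ℚ.< ½ ℚ.* ε
  half ε ε>0 = ℚ.positive⁻¹ (½ ℚ.* ε) {{ℚ.pos*pos⇒pos ½ ε {{ℚ.positive ε>0}}}}

  half+half : ∀ ε → ½ ℚ.* ε ℚ.+ ½ ℚ.* ε ≡ ε
  half+half ε = trans (sym (ℚ.*-distribʳ-+ ε ½ ½)) (ℚ.*-identityˡ ε)

  p≤∣p∣ : ∀ p → p ℚ.≤ ℚ.∣ p ∣
  p≤∣p∣ p with ℚ.≤-total 0ℚ p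
  ... | inj₁ 0≤p = ℚ.≤-reflexive (sym (ℚ.0≤p⇒∣p∣≡p 0≤p))
  ... | inj₂ p≤0 = ℚ.≤-trans p≤0 (ℚ.0≤∣p∣ p)

  p≤q⇒0≤q-p : ∀ {p q} → p ℚ.≤ q → 0ℚ ℚ.≤ q ℚ.- p
  p≤q⇒0≤q-p {p} {q} p≤q = subst (ℚ._≤ q ℚ.- p) (ℚ.+-inverseʳ p) (ℚ.+-monoˡ-≤ (ℚ.- p) p≤q)

  ∣p-q∣≡∣q-p∣ : ∀ p q → ℚ.∣ p ℚ.- q ∣ ≡ ℚ.∣ q ℚ.- p ∣
  ∣p-q∣≡∣q-p∣ p q = trans (sym (ℚ.∣-p∣≡∣p∣ (p ℚ.- q))) (cong ℚ.∣_∣ (ℚ-+.⁻¹-anti-homo‿- p q))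

  p≡q+[p-q] : ∀ p q → p ≡ q ℚ.+ (p ℚ.- q)
  p≡q+[p-q] p q = sym (trans (sym (ℚ.+-assoc q p (ℚ.- q))) (ℚ-+.xyx⁻¹≈y q p))

  p-r≡[p-q]+[q-r] : ∀ p q r → p ℚ.- r ≡ (p ℚ.- q) ℚ.+ (q ℚ.- r)
  p-r≡[p-q]+[q-r] p q r = trans
    (cong (ℚ._- r) (trans (p≡q+[p-q] p q) (ℚ.+-comm q (p ℚ.- q))))
    (ℚ.+-assoc (p ℚ.- q) q (ℚ.- r))

  ∣p-q∣<ε⇒p<q+ε : ∀ p q {ε} → ℚ.∣ p ℚ.- q ∣ ℚ.< ε → p ℚ.< q ℚ.+ ε
  ∣p-q∣<ε⇒p<q+ε p q d = subst (ℚ._< _) (sym (p≡q+[p-q] p q))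
    (ℚ.+-monoʳ-< q (ℚ.≤-<-trans (p≤∣p∣ (p ℚ.- q)) d))

  p<q+ε⇒p-q<ε : ∀ p q {ε} → p ℚ.< q ℚ.+ ε → p ℚ.- q ℚ.< ε
  p<q+ε⇒p-q<ε p q {ε} d = subst (p ℚ.- q ℚ.<_) (ℚ-+.xyx⁻¹≈y q ε) (ℚ.+-monoˡ-< (ℚ.- q) d)

  ∣p-q∣<ε : ∀ p q {ε} → p ℚ.< q ℚ.+ ε → q ℚ.< p ℚ.+ ε → ℚ.∣ p ℚ.- q ∣ ℚ.< ε
  ∣p-q∣<ε p q {ε} l r with ℚ.≤-total q p
  ... | inj₁ q≤p = subst (ℚ._< ε) (sym (ℚ.0≤p⇒∣p∣≡p (p≤q⇒0≤q-p q≤p))) (p<q+ε⇒p-q<ε p q l)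
  ... | inj₂ p≤q = subst (ℚ._< ε)
    (sym (trans (∣p-q∣≡∣q-p∣ p q) (ℚ.0≤p⇒∣p∣≡p (p≤q⇒0≤q-p p≤q)))) (p<q+ε⇒p-q<ε q p r)

  +-cauchy : ∀ x y → IsCauchy x → IsCauchy y → IsCauchy (λ m → x m ℚ.+ y m)
  +-cauchy x y cx cy ε ε>0 with cx (½ ℚ.* ε) (half ε ε>0) | cy (½ ℚ.* ε) (half ε ε>0)
  ... | M , hx | N , hy = M ℕ.⊔ N , λ m n K≤m K≤n → begin-strict
    ℚ.∣ (x m ℚ.+ y m) ℚ.- (x n ℚ.+ y n) ∣          ≡⟨ cong ℚ.∣_∣ (lemma (x m) (y m) (x n) (y n)) ⟩
    ℚ.∣ (x m ℚ.- x n) ℚ.+ (y m ℚ.- y n) ∣          ≤⟨ ℚ.∣p+q∣≤∣p∣+∣q∣ (x m ℚ.- x n) (y m ℚ.- y n) ⟩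
    ℚ.∣ x m ℚ.- x n ∣ ℚ.+ ℚ.∣ y m ℚ.- y n ∣
      <⟨ ℚ.+-mono-< (hx m n (ℕ.m⊔n≤o⇒m≤o M N K≤m) (ℕ.m⊔n≤o⇒m≤o M N K≤n))
                    (hy m n (ℕ.m⊔n≤o⇒n≤o M N K≤m) (ℕ.m⊔n≤o⇒n≤o M N K≤n)) ⟩
    ½ ℚ.* ε ℚ.+ ½ ℚ.* ε                            ≡⟨ half+half ε ⟩
    ε                                              ∎
    where
    open ℚ.≤-Reasoning
    lemma : ∀ a b c d → (a ℚ.+ b) ℚ.- (c ℚ.+ d) ≡ (a ℚ.- c) ℚ.+ (b ℚ.- d)
    lemma a b c d = trans (cong (a ℚ.+ b ℚ.+_) (ℚ.neg-distrib-+ c d))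
      (ℚ-+ₛ.interchange a b (ℚ.- c) (ℚ.- d))

  bounded : ∀ x → IsCauchy x →
            ∃ λ b → 0ℚ ℚ.< b × Eventually λ m → ℚ.∣ x m ∣ ℚ.≤ b
  bounded x cx with cx 1ℚ (ℚ.positive⁻¹ 1ℚ)
  ... | N , hx = ℚ.∣ x N ∣ ℚ.+ 1ℚ
      , ℚ.+-mono-≤-< (ℚ.0≤∣p∣ (x N)) (ℚ.positive⁻¹ 1ℚ)
      , N , λ m N≤m → begin
    ℚ.∣ x m ∣                        ≡⟨ cong ℚ.∣_∣ (p≡q+[p-q] (x m) (x N)) ⟩
    ℚ.∣ x N ℚ.+ (x m ℚ.- x N) ∣      ≤⟨ ℚ.∣p+q∣≤∣p∣+∣q∣ (x N) (x m ℚ.- x N) ⟩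
    ℚ.∣ x N ∣ ℚ.+ ℚ.∣ x m ℚ.- x N ∣  ≤⟨ ℚ.+-monoʳ-≤ ℚ.∣ x N ∣ (ℚ.<⇒≤ (hx m N N≤m ℕ.≤-refl)) ⟩
    ℚ.∣ x N ∣ ℚ.+ 1ℚ                 ∎
    where open ℚ.≤-Reasoning

  scaled : ∀ b → 0ℚ ℚ.< b → ∀ ε → 0ℚ ℚ.< ε →
           ∃ λ δ → 0ℚ ℚ.< δ × (∀ p q → ℚ.∣ p ∣ ℚ.≤ b → ℚ.∣ q ∣ ℚ.< δ → ℚ.∣ p ℚ.* q ∣ ℚ.< ε)
  scaled b b>0 ε ε>0 = δ , ℚ.positive⁻¹ δ , λ p q hp hq → begin-strict
    ℚ.∣ p ℚ.* q ∣        ≡⟨ ℚ.∣p*q∣≡∣p∣*∣q∣ p q ⟩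
    ℚ.∣ p ∣ ℚ.* ℚ.∣ q ∣  ≤⟨ ℚ.*-monoʳ-≤-nonNeg ℚ.∣ q ∣ {{ℚ.∣-∣-nonNeg q}} hp ⟩
    b ℚ.* ℚ.∣ q ∣        <⟨ ℚ.*-monoʳ-<-pos b hq ⟩
    b ℚ.* (ℚ.1/ b ℚ.* ε) ≡⟨ sym (ℚ.*-assoc b (ℚ.1/ b) ε) ⟩
    (b ℚ.* ℚ.1/ b) ℚ.* ε ≡⟨ cong (ℚ._* ε) (ℚ.*-inverseʳ b) ⟩
    1ℚ ℚ.* ε             ≡⟨ ℚ.*-identityˡ ε ⟩
    ε                    ∎
    where
    open ℚ.≤-Reasoning
    instance
      b-pos : ℚ.Positive b
      b-pos = ℚ.positive b>0
      b-nonZero : ℚ.NonZero b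
      b-nonZero = ℚ.pos⇒nonZero b
    δ = ℚ.1/ b ℚ.* ε
    instance
      δ-pos : ℚ.Positive δ
      δ-pos = ℚ.pos*pos⇒pos (ℚ.1/ b) {{ℚ.1/pos⇒pos b}} ε {{ℚ.positive ε>0}}

  *-cauchy : ∀ x y → IsCauchy x → IsCauchy y → IsCauchy (λ m → x m ℚ.* y m)
  *-cauchy x y cx cy ε ε>0
    with bounded x cx | bounded y cy
  ... | a , a>0 , A , hA | b , b>0 , B , hB
    with scaled a a>0 (½ ℚ.* ε) (half ε ε>0) | scaled b b>0 (½ ℚ.* ε) (half ε ε>0)
  ... | η , η>0 , sη | θ , θ>0 , sθ
    with cy η η>0 | cx θ θ>0
  ... | M , hy | N , hx = (A ℕ.⊔ B) ℕ.⊔ (M ℕ.⊔ N) , λ m n K≤m K≤n →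
    let AB≤m = ℕ.m⊔n≤o⇒m≤o (A ℕ.⊔ B) (M ℕ.⊔ N) K≤m
        AB≤n = ℕ.m⊔n≤o⇒m≤o (A ℕ.⊔ B) (M ℕ.⊔ N) K≤n
        MN≤m = ℕ.m⊔n≤o⇒n≤o (A ℕ.⊔ B) (M ℕ.⊔ N) K≤m
        MN≤n = ℕ.m⊔n≤o⇒n≤o (A ℕ.⊔ B) (M ℕ.⊔ N) K≤n
    in begin-strict
    ℚ.∣ x m ℚ.* y m ℚ.- x n ℚ.* y n ∣
      ≡⟨ cong ℚ.∣_∣ (lemma (x m) (y m) (x n) (y n)) ⟩
    ℚ.∣ x m ℚ.* (y m ℚ.- y n) ℚ.+ y n ℚ.* (x m ℚ.- x n) ∣
      ≤⟨ ℚ.∣p+q∣≤∣p∣+∣q∣ (x m ℚ.* (y m ℚ.- y n)) (y n ℚ.* (x m ℚ.- x n)) ⟩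
    ℚ.∣ x m ℚ.* (y m ℚ.- y n) ∣ ℚ.+ ℚ.∣ y n ℚ.* (x m ℚ.- x n) ∣
      <⟨ ℚ.+-mono-<
           (sη (x m) (y m ℚ.- y n) (hA m (ℕ.m⊔n≤o⇒m≤o A B AB≤m))
               (hy m n (ℕ.m⊔n≤o⇒m≤o M N MN≤m) (ℕ.m⊔n≤o⇒m≤o M N MN≤n)))
           (sθ (y n) (x m ℚ.- x n) (hB n (ℕ.m⊔n≤o⇒n≤o A B AB≤n))
               (hx m n (ℕ.m⊔n≤o⇒n≤o M N MN≤m) (ℕ.m⊔n≤o⇒n≤o M N MN≤n))) ⟩
    ½ ℚ.* ε ℚ.+ ½ ℚ.* ε
      ≡⟨ half+half ε ⟩
    ε ∎
    where
    open ℚ.≤-Reasoning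
    lemma : ∀ a b c d → a ℚ.* b ℚ.- c ℚ.* d ≡ a ℚ.* (b ℚ.- d) ℚ.+ d ℚ.* (a ℚ.- c)
    lemma a b c d = trans (p-r≡[p-q]+[q-r] (a ℚ.* b) (a ℚ.* d) (c ℚ.* d)) (cong₂ ℚ._+_
      (sym (ℚ-*.x[y-z]≈xy-xz a b d))
      (trans (sym (ℚ-*.[y-z]x≈yx-zx d a c)) (ℚ.*-comm (a ℚ.- c) d)))

  ⊔-<-+ : ∀ p q r s {ε} → p ℚ.< r ℚ.+ ε → q ℚ.< s ℚ.+ ε → p ℚ.⊔ q ℚ.< (r ℚ.⊔ s) ℚ.+ ε
  ⊔-<-+ p q r s {ε} l k with ℚ.≤-total p q
  ... | inj₁ p≤q = subst (ℚ._< _) (sym (ℚ.p≤q⇒p⊔q≡q p≤q))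
    (ℚ.<-≤-trans k (ℚ.+-monoˡ-≤ ε (ℚ.p≤q⊔p r s)))
  ... | inj₂ q≤p = subst (ℚ._< _) (sym (ℚ.p≥q⇒p⊔q≡p q≤p))
    (ℚ.<-≤-trans l (ℚ.+-monoˡ-≤ ε (ℚ.p≤p⊔q r s)))

  ⊔-cauchy : ∀ x y → IsCauchy x → IsCauchy y → IsCauchy (λ m → x m ℚ.⊔ y m)
  ⊔-cauchy x y cx cy ε ε>0 with cx ε ε>0 | cy ε ε>0
  ... | M , hx | N , hy = M ℕ.⊔ N , λ m n K≤m K≤n →
    let M≤m = ℕ.m⊔n≤o⇒m≤o M N K≤m
        M≤n = ℕ.m⊔n≤o⇒m≤o M N K≤n
        N≤m = ℕ.m⊔n≤o⇒n≤o M N K≤m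
        N≤n = ℕ.m⊔n≤o⇒n≤o M N K≤n
    in ∣p-q∣<ε (x m ℚ.⊔ y m) (x n ℚ.⊔ y n)
      (⊔-<-+ (x m) (y m) (x n) (y n)
        (∣p-q∣<ε⇒p<q+ε (x m) (x n) (hx m n M≤m M≤n))
        (∣p-q∣<ε⇒p<q+ε (y m) (y n) (hy m n N≤m N≤n)))
      (⊔-<-+ (x n) (y n) (x m) (y m)
        (∣p-q∣<ε⇒p<q+ε (x n) (x m) (hx n m M≤n M≤m))
        (∣p-q∣<ε⇒p<q+ε (y n) (y m) (hy n m N≤n N≤m)))

fromℚ : ℚ → ℝ
fromℚ q = mkℝ (λ _ → q) λ ε ε>0 → 0 , λ _ _ _ _ →
  subst (ℚ._< ε) (sym (cong ℚ.∣_∣ (ℚ.+-inverseʳ q))) ε>0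

0ℝ : ℝ
0ℝ = fromℚ 0ℚ

infixl 6 _+ℝ_ _⊔ℝ_
infixl 7 _*ℝ_

_+ℝ_ : ℝ → ℝ → ℝ
x +ℝ y = mkℝ (λ m → seq x m ℚ.+ seq y m) (+-cauchy (seq x) (seq y) (cauchy x) (cauchy y))

_*ℝ_ : ℝ → ℝ → ℝ
x *ℝ y = mkℝ (λ m → seq x m ℚ.* seq y m) (*-cauchy (seq x) (seq y) (cauchy x) (cauchy y))

_⊔ℝ_ : ℝ → ℝ → ℝ
x ⊔ℝ y = mkℝ (λ m → seq x m ℚ.⊔ seq y m) (⊔-cauchy (seq x) (seq y) (cauchy x) (cauchy y))

+ℝ-0ℝ-rawMonoid : RawMonoid 0ℓ 0ℓ
+ℝ-0ℝ-rawMonoid = record { Carrier = ℝ ; _≈_ = _≈ℝ_ ; _∙_ = _+ℝ_ ; ε = 0ℝ }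

open import Algebra.Definitions.RawMonoid +ℝ-0ℝ-rawMonoid public using () renaming (sum to ∑)

------------------------------------------------------------------------
-- Finite sets

comprehension : ∀ {n} {P : Pred (Fin n) 0ℓ} → Decidable P → Subset n
comprehension P? = tabulate (does ∘ P?)

allSubsets : ∀ n → List (Subset n)
allSubsets zero    = List.[ [] ]
allSubsets (suc n) =
  List.map (outside ∷_) (allSubsets n) ++ List.map (inside ∷_) (allSubsets n)

------------------------------------------------------------------------
-- Graphs

record Graph (n : ℕ) : Set₁ where
  field
    Adj        : Fin n → Fin n → Set
    adj?       : B.Decidable Adj
    adj-sym    : B.Symmetric Adj
    adj-irrefl : ∀ u → ¬ Adj u u

module _ {n : ℕ} (G : Graph n) where
  open Graph G

  neighbours : Fin n → Subset n
  neighbours u = comprehension (adj? u)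

  degree : Fin n → ℕ
  degree u = ∣ neighbours u ∣

  Connected : Set
  Connected = ∀ u v → Star Adj u v

  IsClique : Set
  IsClique = ∀ u v → u ≢ v → Adj u v

weight : ∀ {n} → (Fin n → ℝ) → Subset n → ℝ
weight c I = ∑ (λ u → if does (u ∈? I) then c u else 0ℝ)

------------------------------------------------------------------------
-- Degenerate sets

module _ {n k : ℕ} (us : Vec (Fin n) k) where

  Precedes : Fin k → Pred (Fin n) 0ℓ
  Precedes i v = ∃ λ j → j Fin.< i × lookup us j ≡ v

  precedes? : ∀ i → Decidable (Precedes i)
  precedes? i v = Fin.any? λ j → (j Fin.<? i) ×-dec (lookup us j Fin.≟ v)

  predecessors : Fin k → Subset n
  predecessors i = comprehension (precedes? i)

module _ {n : ℕ} (G : Graph n) (κ : Fin n → ℤ) where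

  record IsDegenerateOrdering (I : Subset n) {k : ℕ} (us : Vec (Fin n) k) : Set where
    field
      distinct   : Injective _≡_ _≡_ (lookup us)
      enumerates : ∀ v → v ∈ I ⇔ (∃ λ i → lookup us i ≡ v)
      bound      : ∀ i → + ∣ neighbours G (lookup us i) ∩ predecessors us i ∣ ℤ.≤ κ (lookup us i)

  Degenerate : Subset n → Set
  Degenerate I = ∃ λ k → ∃ λ (us : Vec (Fin n) k) → IsDegenerateOrdering I us

  private
    _⇔-dec_ : ∀ {A B : Set} → Dec A → Dec B → Dec (A ⇔ B)
    a? ⇔-dec b? = map′ (λ (f , g) → mk⇔ f g) (λ e → Equivalence.to e , Equivalence.from e)
      ((a? →-dec b?) ×-dec (b? →-dec a?))

    anyVec? : ∀ k {P : Pred (Vec (Fin n) k) 0ℓ} → Decidable P → Dec (∃ P)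
    anyVec? zero    P? = map′ ([] ,_) (λ { ([] , p) → p }) (P? [])
    anyVec? (suc k) P? = map′ (λ (x , xs , p) → x ∷ xs , p) (λ { (x ∷ xs , p) → x , xs , p })
      (Fin.any? λ x → anyVec? k (P? ∘ (x ∷_)))

    isDegenerateOrdering? : ∀ I {k} → Decidable (IsDegenerateOrdering I {k})
    isDegenerateOrdering? I us = map′
      (λ (d , e , b) → record { distinct = λ {i} {j} → d i j ; enumerates = e ; bound = b })
      (λ o → let open IsDegenerateOrdering o in (λ _ _ → distinct) , enumerates , bound)
      (Fin.all? (λ i → Fin.all? λ j → (lookup us i Fin.≟ lookup us j) →-dec (i Fin.≟ j))
        ×-dec Fin.all? (λ v → (v ∈? I) ⇔-dec Fin.any? (λ i → lookup us i Fin.≟ v))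
        ×-dec Fin.all? (λ i → _ ℤ.≤? _))

  degenerate? : Decidable Degenerate
  degenerate? I = map′
    (λ (k , o) → Fin.toℕ k , o)
    (λ (k , us , o) →
      let k<1+n = s≤s (Fin.injective⇒≤ (IsDegenerateOrdering.distinct o)) in
      Fin.fromℕ< k<1+n ,
      subst (λ k → ∃ λ (us : Vec (Fin n) k) → IsDegenerateOrdering I us)
            (sym (Fin.toℕ-fromℕ< k<1+n)) (us , o))
    (Fin.any? {n = suc n} λ k → anyVec? (Fin.toℕ k) (isDegenerateOrdering? I))

-- The base value 0ℝ of the maximum is the weight of the empty set, which is
-- always degenerate (so it occurs in the list as well).
α : ∀ {n} → Graph n → (Fin n → ℝ) → (Fin n → ℤ) → ℝ
α {n} G c κ = foldr _⊔ℝ_ 0ℝ (List.map (weight c) (filter (degenerate? G κ) (allSubsets n)))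

{-# OPTIONS --safe #-}

-- Order V(G) uniformly at random and keep every vertex u that is preceded by at most κ(u) of its
-- neighbours: the kept set is κ-degenerate and its expected weight is the right-hand side. For an
-- induced subgraph G[S] write E(S) for this expectation. Conditioning on the last vertex v of S
-- gives E(S) as the average over v of [d_S(v) ≤ κ(v)] c(v) + E(S - v), each of which is at most the
-- maximum weight for S. Hence, if the maximum is E(S), all of these terms are equal to E(S), and
-- the maximum for every S - v is E(S - v); so equality at V(G) passes to all induced subgraphs.
--
-- Call v saturated in S if d_S(v) ≤ κ(v). Equality of the terms shows that saturation in S spreads
-- along the edges of G[S]. Connectedness gives case (i), or no vertex is saturated in V(G). In the
-- latter case let S consist of v and κ(v) + 1 of its neighbours: v is unsaturated in S, hence so
-- are its neighbours, which gives κ(u) ≤ κ(v) for adjacent u and v, so κ is constant, S is a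
-- clique, and comparing the terms of two vertices of S gives equal weights. If κ ≥ 1, two
-- neighbours of v can be put into the same S, so adjacency is transitive; if κ = 0, the same
-- follows from the terms of an induced path on three vertices.
--
-- The weights are limits of rational sequences, so all of this is done for the rational
-- approximations of c, with equalities weakened to inequalities up to an error that tends to 0.

module Submission where

open import Defs
open import Algebra.Bundles using (CommutativeRing)
open import Data.Bool.Base using (if_then_else_; true; false)
open import Data.Fin.Base as Fin using (Fin; zero; suc; fromℕ; inject₁)
import Data.Fin.Properties as Fin
open import Data.Fin.Relation.Unary.Top using (view; ‵fromℕ; ‵inject₁)
open import Data.Fin.Subset using (Subset; inside; outside; _∈_; _∉_; _⊆_; _∩_; _∪_; _-_; ∣_∣; ⁅_⁆; ⊤; ⊥; ∁; Nonempty)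
open import Data.Fin.Subset.Properties
open import Data.Integer.Base as ℤ using (ℤ; +_; 0ℤ; 1ℤ; _+_; _≤_)
import Data.Integer.Properties as ℤ
open import Data.List.Base as List using (foldr)
open import Data.List.Membership.Propositional using () renaming (_∈_ to _∈ₗ_)
open import Data.List.Membership.Propositional.Properties using (∈-map⁺; ∈-++⁺ˡ; ∈-++⁺ʳ; ∈-filter⁺)
open import Data.List.Relation.Unary.All as All using (All)
open import Data.List.Relation.Unary.All.Properties as All using (all-filter)
import Data.List.Relation.Unary.Any as Any
open import Data.Nat.Base as ℕ using (ℕ; zero; suc; s≤s; z≤n)
import Data.Nat.Properties as ℕ
open import Data.Product.Base using (∃; _×_; _,_; proj₁; proj₂)
open import Data.Rational.Base as ℚ using (ℚ; 0ℚ; 1ℚ; _/_)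
import Data.Rational.Properties as ℚ
open import Data.Rational.Solver using (module +-*-Solver)
import Data.Rational.Unnormalised.Base as ℚᵘ
import Data.Rational.Unnormalised.Properties as ℚᵘ
open import Data.Sum.Base using (_⊎_; inj₁; inj₂)
open import Data.Unit.Base using (tt)
open import Data.Vec.Base using (Vec; []; _∷_; lookup; here; there; _∷ʳ_)
open import Data.Vec.Properties using (lookup∘tabulate; []=⇒lookup; lookup⇒[]=)
open import Function.Base using (_∘_; _$_; case_of_)
open import Function.Bundles using (_⇔_; mk⇔; Equivalence)
open import Level using (0ℓ)
open import Relation.Binary.Construct.Closure.ReflexiveTransitive using (Star; _◅_) renaming (ε to nil)
open import Relation.Binary.PropositionalEquality using (_≡_; _≢_; refl; sym; trans; cong; cong₂; subst; subst₂; module ≡-Reasoning)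
open import Relation.Nullary using (¬_; Dec; does; yes; no; contradiction)
open import Relation.Nullary.Decidable using (dec-true; dec-false; _×-dec_)
open import Relation.Unary using (Pred; Decidable)

open import Algebra.Properties.CommutativeMonoid.Sum ℚ.+-0-commutativeMonoid using (sum; sum-cong-≗; sum-replicate-zero; ∑-distrib-+; ∑-comm)
open import Algebra.Properties.Semiring.Sum (CommutativeRing.semiring ℚ.+-*-commutativeRing) using (*-distribˡ-sum)
open +-*-Solver using (solve; _:+_; _:*_; _:-_; :-_; _:=_; con)

-- Rational arithmetic

-- Defined by recursion so that `ι (suc n)` unfolds to `1ℚ ℚ.+ ι n`, which the ring solver can treat
-- as a polynomial in `ι n`.
ι : ℕ → ℚ
ι zero    = 0ℚ
ι (suc n) = 1ℚ ℚ.+ ι n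

ι-+ : ∀ m n → ι (m ℕ.+ n) ≡ ι m ℚ.+ ι n
ι-+ zero    n = sym (ℚ.+-identityˡ (ι n))
ι-+ (suc m) n = trans (cong (1ℚ ℚ.+_) (ι-+ m n)) (sym (ℚ.+-assoc 1ℚ (ι m) (ι n)))

toℚᵘ-ι : ∀ n → ℚ.toℚᵘ (ι n) ℚᵘ.≃ ℚᵘ.mkℚᵘ (+ n) 0
toℚᵘ-ι zero    = ℚᵘ.≃-refl
toℚᵘ-ι (suc n) = begin
  ℚ.toℚᵘ (1ℚ ℚ.+ ι n)            ≈⟨ ℚ.toℚᵘ-homo-+ 1ℚ (ι n) ⟩
  ℚᵘ.1ℚᵘ ℚᵘ.+ ℚ.toℚᵘ (ι n)       ≈⟨ ℚᵘ.+-congʳ ℚᵘ.1ℚᵘ (toℚᵘ-ι n) ⟩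
  ℚᵘ.1ℚᵘ ℚᵘ.+ ℚᵘ.mkℚᵘ (+ n) 0    ≈⟨ ℚᵘ.*≡* (cong (λ i → (+ 1 ℤ.+ i) ℤ.* + 1) (ℤ.*-identityʳ (+ n))) ⟩
  ℚᵘ.mkℚᵘ (+ suc n) 0            ∎
  where open ℚᵘ.≃-Reasoning

-- The bridge between `ι` and fractions. It is proved for unnormalised rationals, where equality is
-- cross-multiplication and the normalisation done by `/` disappears.
ι-suc-*-/ : ∀ a d → ι (suc d) ℚ.* (+ a / suc d) ≡ ι a
ι-suc-*-/ a d = ℚ.toℚᵘ-injective $ begin
  ℚ.toℚᵘ (ι (suc d) ℚ.* (+ a / suc d))  ≈⟨ ℚ.toℚᵘ-homo-* (ι (suc d)) (+ a / suc d) ⟩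
  ℚ.toℚᵘ (ι (suc d)) ℚᵘ.* ℚ.toℚᵘ (+ a / suc d)
    ≈⟨ ℚᵘ.*-cong (toℚᵘ-ι (suc d)) (ℚ.toℚᵘ-fromℚᵘ (ℚᵘ.mkℚᵘ (+ a) d)) ⟩
  ℚᵘ.mkℚᵘ (+ suc d) 0 ℚᵘ.* ℚᵘ.mkℚᵘ (+ a) d
    ≈⟨ ℚᵘ.*≡* (trans (ℤ.*-identityʳ (+ suc d ℤ.* + a)) (trans (ℤ.*-comm (+ suc d) (+ a))
                (cong (λ e → + a ℤ.* + suc e) (sym (ℕ.+-identityʳ d))))) ⟩
  ℚᵘ.mkℚᵘ (+ a) 0                       ≈⟨ toℚᵘ-ι a ⟨
  ℚ.toℚᵘ (ι a)                          ∎
  where open ℚᵘ.≃-Reasoning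

0<1ℚ : 0ℚ ℚ.< 1ℚ
0<1ℚ = ℚ.positive⁻¹ 1ℚ

0≤ι : ∀ n → 0ℚ ℚ.≤ ι n
0≤ι zero    = ℚ.≤-refl
0≤ι (suc n) = ℚ.+-mono-≤ (ℚ.<⇒≤ 0<1ℚ) (0≤ι n)

ι-mono-≤ : ∀ {m n} → m ℕ.≤ n → ι m ℚ.≤ ι n
ι-mono-≤ {m} {n} m≤n = begin
  ι m                    ≡⟨ ℚ.+-identityʳ (ι m) ⟨
  ι m ℚ.+ 0ℚ             ≤⟨ ℚ.+-monoʳ-≤ (ι m) (0≤ι (n ℕ.∸ m)) ⟩
  ι m ℚ.+ ι (n ℕ.∸ m)    ≡⟨ ι-+ m (n ℕ.∸ m) ⟨
  ι (m ℕ.+ (n ℕ.∸ m))    ≡⟨ cong ι (ℕ.m+[n∸m]≡n m≤n) ⟩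
  ι n                    ∎
  where open ℚ.≤-Reasoning

*-monoˡ-≤ : ∀ {r p q} → 0ℚ ℚ.≤ r → p ℚ.≤ q → r ℚ.* p ℚ.≤ r ℚ.* q
*-monoˡ-≤ {r} 0≤r = ℚ.*-monoˡ-≤-nonNeg r {{ℚ.nonNegative 0≤r}}

*-monoʳ-≤ : ∀ {r p q} → 0ℚ ℚ.≤ r → p ℚ.≤ q → p ℚ.* r ℚ.≤ q ℚ.* r
*-monoʳ-≤ {r} 0≤r = ℚ.*-monoʳ-≤-nonNeg r {{ℚ.nonNegative 0≤r}}

0≤p*q : ∀ {p q} → 0ℚ ℚ.≤ p → 0ℚ ℚ.≤ q → 0ℚ ℚ.≤ p ℚ.* q
0≤p*q {p} {q} 0≤p 0≤q = subst (ℚ._≤ p ℚ.* q) (ℚ.*-zeroʳ p) (*-monoˡ-≤ 0≤p 0≤q)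

0<p*q : ∀ {p q} → 0ℚ ℚ.< p → 0ℚ ℚ.< q → 0ℚ ℚ.< p ℚ.* q
0<p*q {p} {q} 0<p 0<q =
  subst (ℚ._< p ℚ.* q) (ℚ.*-zeroʳ p) (ℚ.*-monoʳ-<-pos p {{ℚ.positive 0<p}} 0<q)

p≤q+p : ∀ {p q} → 0ℚ ℚ.≤ q → p ℚ.≤ q ℚ.+ p
p≤q+p {p} {q} 0≤q = subst (ℚ._≤ q ℚ.+ p) (ℚ.+-identityˡ p) (ℚ.+-monoˡ-≤ p 0≤q)

p≤p+q : ∀ {p q} → 0ℚ ℚ.≤ q → p ℚ.≤ p ℚ.+ q
p≤p+q {p} {q} 0≤q = subst (ℚ._≤ p ℚ.+ q) (ℚ.+-identityʳ p) (ℚ.+-monoʳ-≤ p 0≤q)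

p≤q⇒0≤q-p : ∀ {p q} → p ℚ.≤ q → 0ℚ ℚ.≤ q ℚ.- p
p≤q⇒0≤q-p {p} {q} p≤q = subst (ℚ._≤ q ℚ.- p) (ℚ.+-inverseʳ p) (ℚ.+-monoˡ-≤ (ℚ.- p) p≤q)

p<q⇒0<q-p : ∀ {p q} → p ℚ.< q → 0ℚ ℚ.< q ℚ.- p
p<q⇒0<q-p {p} {q} p<q = subst (ℚ._< q ℚ.- p) (ℚ.+-inverseʳ p) (ℚ.+-monoˡ-< (ℚ.- p) p<q)

+-cancelˡ-≤ : ∀ r {p q} → r ℚ.+ p ℚ.≤ r ℚ.+ q → p ℚ.≤ q
+-cancelˡ-≤ r {p} {q} h = subst₂ ℚ._≤_ (lemma p) (lemma q) (ℚ.+-monoʳ-≤ (ℚ.- r) h)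
  where
  lemma : ∀ p → ℚ.- r ℚ.+ (r ℚ.+ p) ≡ p
  lemma = solve 2 (λ r p → :- r :+ (r :+ p) := p) refl r

q+[p-q]≡p : ∀ p q → q ℚ.+ (p ℚ.- q) ≡ p
q+[p-q]≡p = solve 2 (λ p q → q :+ (p :- q) := p) refl

∣p-q∣<ε⇒p<q+ε : ∀ {p q ε} → ℚ.∣ p ℚ.- q ∣ ℚ.< ε → p ℚ.< q ℚ.+ ε
∣p-q∣<ε⇒p<q+ε {p} {q} d = subst (ℚ._< _) (q+[p-q]≡p p q)
  (ℚ.+-monoʳ-< q (ℚ.≤-<-trans (p≤∣p∣ (p ℚ.- q)) d))
  where
  p≤∣p∣ : ∀ p → p ℚ.≤ ℚ.∣ p ∣
  p≤∣p∣ p with ℚ.≤-total 0ℚ p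
  ... | inj₁ 0≤p = ℚ.≤-reflexive (sym (ℚ.0≤p⇒∣p∣≡p 0≤p))
  ... | inj₂ p≤0 = ℚ.≤-trans p≤0 (ℚ.0≤∣p∣ p)

∣p-q∣≡∣q-p∣ : ∀ p q → ℚ.∣ p ℚ.- q ∣ ≡ ℚ.∣ q ℚ.- p ∣
∣p-q∣≡∣q-p∣ p q = trans (sym (ℚ.∣-p∣≡∣p∣ (p ℚ.- q)))
  (cong ℚ.∣_∣ (solve 2 (λ p q → :- (p :- q) := q :- p) refl p q))

p<q+ε⇒p-q<ε : ∀ {p q ε} → p ℚ.< q ℚ.+ ε → p ℚ.- q ℚ.< ε
p<q+ε⇒p-q<ε {p} {q} {ε} p<q+ε = subst (p ℚ.- q ℚ.<_)
  (solve 2 (λ q ε → (q :+ ε) :- q := ε) refl q ε) (ℚ.+-monoˡ-< (ℚ.- q) p<q+ε)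

p<q+ε⇒∣p-q∣<ε : ∀ {p q ε} → p ℚ.< q ℚ.+ ε → q ℚ.< p ℚ.+ ε → ℚ.∣ p ℚ.- q ∣ ℚ.< ε
p<q+ε⇒∣p-q∣<ε {p} {q} {ε} p<q+ε q<p+ε with ℚ.≤-total q p
... | inj₁ q≤p = subst (ℚ._< ε) (sym (ℚ.0≤p⇒∣p∣≡p (p≤q⇒0≤q-p q≤p))) (p<q+ε⇒p-q<ε p<q+ε)
... | inj₂ p≤q = subst (ℚ._< ε)
  (trans (sym (ℚ.0≤p⇒∣p∣≡p (p≤q⇒0≤q-p p≤q))) (∣p-q∣≡∣q-p∣ q p)) (p<q+ε⇒p-q<ε q<p+ε)

∃[δ]rδ<ε : ∀ r ε → 0ℚ ℚ.≤ r → 0ℚ ℚ.< ε → ∃ λ δ → 0ℚ ℚ.< δ × r ℚ.* δ ℚ.< ε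
∃[δ]rδ<ε r ε 0≤r 0<ε = ℚ.1/ s ℚ.* ε , 0<δ , (begin-strict
  r ℚ.* (ℚ.1/ s ℚ.* ε)   <⟨ ℚ.*-monoˡ-<-pos (ℚ.1/ s ℚ.* ε) {{ℚ.positive 0<δ}} r<s ⟩
  s ℚ.* (ℚ.1/ s ℚ.* ε)   ≡⟨ ℚ.*-assoc s (ℚ.1/ s) ε ⟨
  (s ℚ.* ℚ.1/ s) ℚ.* ε   ≡⟨ cong (ℚ._* ε) (ℚ.*-inverseʳ s) ⟩
  1ℚ ℚ.* ε               ≡⟨ ℚ.*-identityˡ ε ⟩
  ε                      ∎)
  where
  open ℚ.≤-Reasoning
  -- Since `r` may be 0, the division is by 1 + r.
  s = 1ℚ ℚ.+ r
  r<s : r ℚ.< s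
  r<s = subst (ℚ._< s) (ℚ.+-identityˡ r) (ℚ.+-monoˡ-< r 0<1ℚ)
  instance
    s-positive : ℚ.Positive s
    s-positive = ℚ.positive (ℚ.≤-<-trans 0≤r r<s)
    s-nonZero : ℚ.NonZero s
    s-nonZero = ℚ.pos⇒nonZero s
  0<δ : 0ℚ ℚ.< ℚ.1/ s ℚ.* ε
  0<δ = 0<p*q (ℚ.positive⁻¹ (ℚ.1/ s) {{ℚ.1/pos⇒pos s}}) 0<ε

-- Abstract, since unfolding the division by 1 + r makes conversion checking blow up.
abstract
  shrink : ∀ r ε → 0ℚ ℚ.≤ r → 0ℚ ℚ.< ε → ∃ λ δ → 0ℚ ℚ.< δ × r ℚ.* δ ℚ.< ε
  shrink = ∃[δ]rδ<ε

-- Iverson brackets and sums over subsets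

when : ∀ {P : Set} → Dec P → ℚ → ℚ
when P? x = if does P? then x else 0ℚ

module _ {P : Set} (P? : Dec P) {x : ℚ} where

  when-true : P → when P? x ≡ x
  when-true p = cong (if_then x else 0ℚ) (dec-true P? p)

  when-false : ¬ P → when P? x ≡ 0ℚ
  when-false ¬p = cong (if_then x else 0ℚ) (dec-false P? ¬p)

when-cong : ∀ {P : Set} (P? : Dec P) {x y} → (P → x ≡ y) → when P? x ≡ when P? y
when-cong (yes p) x≡y = x≡y p
when-cong (no _)  _   = refl

when-mono : ∀ {P : Set} (P? : Dec P) {x y} → (P → x ℚ.≤ y) → when P? x ℚ.≤ when P? y
when-mono (yes p) x≤y = x≤y p
when-mono (no _)  _   = ℚ.≤-refl

when-+ : ∀ {P : Set} (P? : Dec P) x y → when P? (x ℚ.+ y) ≡ when P? x ℚ.+ when P? y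
when-+ P? x y with does P?
... | true  = refl
... | false = refl

when-sum : ∀ {P : Set} (P? : Dec P) {n} (f : Fin n → ℚ) → when P? (sum f) ≡ sum (λ i → when P? (f i))
when-sum P? {n} f with does P?
... | true  = refl
... | false = sym (sum-replicate-zero n)

sum-mono : ∀ {n} {f g : Fin n → ℚ} → (∀ i → f i ℚ.≤ g i) → sum f ℚ.≤ sum g
sum-mono {zero}  f≤g = ℚ.≤-refl
sum-mono {suc n} f≤g = ℚ.+-mono-≤ (f≤g zero) (sum-mono (f≤g ∘ suc))

sum-< : ∀ {n} {f g : Fin n → ℚ} → (∀ i → f i ℚ.≤ g i) → ∀ i → f i ℚ.< g i → sum f ℚ.< sum g
sum-< f≤g zero    f<g = ℚ.+-mono-<-≤ f<g (sum-mono (f≤g ∘ suc))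
sum-< f≤g (suc i) f<g = ℚ.+-mono-≤-< (f≤g zero) (sum-< (f≤g ∘ suc) i f<g)

sumOn : ∀ {n} → Subset n → (Fin n → ℚ) → ℚ
sumOn S f = sum (λ u → when (u ∈? S) (f u))

module _ {n : ℕ} (S : Subset n) where

  sumOn-cong : ∀ {f g} → (∀ {u} → u ∈ S → f u ≡ g u) → sumOn S f ≡ sumOn S g
  sumOn-cong f≡g = sum-cong-≗ λ u → when-cong (u ∈? S) f≡g

  sumOn-mono : ∀ {f g} → (∀ {u} → u ∈ S → f u ℚ.≤ g u) → sumOn S f ℚ.≤ sumOn S g
  sumOn-mono f≤g = sum-mono λ u → when-mono (u ∈? S) f≤g

  sumOn-+ : ∀ f g → sumOn S (λ u → f u ℚ.+ g u) ≡ sumOn S f ℚ.+ sumOn S g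
  sumOn-+ f g = trans (sum-cong-≗ λ u → when-+ (u ∈? S) (f u) (g u))
    (∑-distrib-+ (λ u → when (u ∈? S) (f u)) (λ u → when (u ∈? S) (g u)))

sumOn-const : ∀ {n} (S : Subset n) x → sumOn S (λ _ → x) ≡ ι ∣ S ∣ ℚ.* x
sumOn-const []            x = sym (ℚ.*-zeroˡ x)
sumOn-const (outside ∷ S) x = trans (ℚ.+-identityˡ _) (sumOn-const S x)
sumOn-const (inside ∷ S)  x = begin
  x ℚ.+ sumOn S (λ _ → x)        ≡⟨ cong (x ℚ.+_) (sumOn-const S x) ⟩
  x ℚ.+ ι ∣ S ∣ ℚ.* x            ≡⟨ solve 2 (λ x i → x :+ i :* x := (con 1ℚ :+ i) :* x) refl x (ι ∣ S ∣) ⟩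
  ι (suc ∣ S ∣) ℚ.* x            ∎
  where open ≡-Reasoning

sumOn-⁅⁆ : ∀ {n} (v : Fin n) x → sumOn ⁅ v ⁆ (λ _ → x) ≡ x
sumOn-⁅⁆ v x = trans (sumOn-const ⁅ v ⁆ x)
  (trans (cong (λ k → ι k ℚ.* x) (∣⁅x⁆∣≡1 v)) (ℚ.*-identityˡ x))

x∉p-x : ∀ {n} {x : Fin n} (p : Subset n) → x ∉ p - x
x∉p-x {x = zero}  (_ ∷ p) ()
x∉p-x {x = suc x} (_ ∷ p) (there x∈) = x∉p-x p x∈

x∈p-y⇒x∈p : ∀ {n} {x : Fin n} (p : Subset n) y → x ∈ p - y → x ∈ p
x∈p-y⇒x∈p p y = p─q⊆p p ⁅ y ⁆

x∈p-y⇒x≢y : ∀ {n} {x y : Fin n} (p : Subset n) → x ∈ p - y → x ≢ y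
x∈p-y⇒x≢y p x∈ refl = x∉p-x p x∈

∣p∣≤1+∣p-x∣ : ∀ {n} (p : Subset n) x → ∣ p ∣ ℕ.≤ suc ∣ p - x ∣
∣p∣≤1+∣p-x∣ (inside ∷ p)  zero    = s≤s (ℕ.≤-reflexive (cong ∣_∣ (sym (p─⊥≡p p))))
∣p∣≤1+∣p-x∣ (outside ∷ p) zero    = ℕ.m≤n⇒m≤1+n (ℕ.≤-reflexive (cong ∣_∣ (sym (p─⊥≡p p))))
∣p∣≤1+∣p-x∣ (inside ∷ p)  (suc x) = s≤s (∣p∣≤1+∣p-x∣ p x)
∣p∣≤1+∣p-x∣ (outside ∷ p) (suc x) = ∣p∣≤1+∣p-x∣ p x

x∈p⇒1+∣p-x∣≡∣p∣ : ∀ {n} {x : Fin n} (p : Subset n) → x ∈ p → suc ∣ p - x ∣ ≡ ∣ p ∣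
x∈p⇒1+∣p-x∣≡∣p∣ p x∈p = ℕ.≤-antisym (x∈p⇒∣p-x∣<∣p∣ x∈p) (∣p∣≤1+∣p-x∣ p _)

-- The indicator of `S` is the indicator of the singleton of `v` plus that of `S - v`.
sumOn-remove : ∀ {n} (S : Subset n) {v} → v ∈ S → ∀ f → sumOn S f ≡ f v ℚ.+ sumOn (S - v) f
sumOn-remove S {v} v∈S f = begin
  sumOn S f                                                     ≡⟨ sum-cong-≗ pointwise ⟩
  sum (λ u → when (u ∈? ⁅ v ⁆) (f v) ℚ.+ when (u ∈? S - v) (f u))
    ≡⟨ ∑-distrib-+ (λ u → when (u ∈? ⁅ v ⁆) (f v)) (λ u → when (u ∈? S - v) (f u)) ⟩
  sumOn ⁅ v ⁆ (λ _ → f v) ℚ.+ sumOn (S - v) f                   ≡⟨ cong (ℚ._+ sumOn (S - v) f) (sumOn-⁅⁆ v (f v)) ⟩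
  f v ℚ.+ sumOn (S - v) f                                       ∎
  where
  open ≡-Reasoning
  pointwise : ∀ u → when (u ∈? S) (f u) ≡ when (u ∈? ⁅ v ⁆) (f v) ℚ.+ when (u ∈? S - v) (f u)
  pointwise u with u Fin.≟ v
  ... | yes refl = trans (when-true (u ∈? S) v∈S) (sym (trans
    (cong₂ ℚ._+_ (when-true (u ∈? ⁅ u ⁆) (x∈⁅x⁆ u)) (when-false (u ∈? S - u) (x∉p-x S))) (ℚ.+-identityʳ (f u))))
  ... | no u≢v = sym (trans (cong (ℚ._+ when (u ∈? S - v) (f u)) (when-false (u ∈? ⁅ v ⁆) (x≢y⇒x∉⁅y⁆ u≢v)))
    (trans (ℚ.+-identityˡ _) same))
    where
    same : when (u ∈? S - v) (f u) ≡ when (u ∈? S) (f u)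
    same with u ∈? S
    ... | yes u∈S = when-true (u ∈? S - v) (x∈p∧x≢y⇒x∈p-y u∈S u≢v)
    ... | no u∉S  = when-false (u ∈? S - v) (u∉S ∘ x∈p-y⇒x∈p S v)

sumOn-⊤ : ∀ {n} (f : Fin n → ℚ) → sumOn ⊤ f ≡ sum f
sumOn-⊤ f = sum-cong-≗ {y = f} λ u → when-true (u ∈? ⊤) ∈⊤

sumOn-≤-sum : ∀ {n} (S : Subset n) {f} → (∀ u → 0ℚ ℚ.≤ f u) → sumOn S f ℚ.≤ sum f
sumOn-≤-sum S {f} 0≤f = sum-mono λ u → pointwise u
  where
  pointwise : ∀ u → when (u ∈? S) (f u) ℚ.≤ f u
  pointwise u with does (u ∈? S)
  ... | true  = ℚ.≤-refl
  ... | false = 0≤f u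

-- Probabilities in a random ordering

n/n≡1 : ∀ d → + suc d / suc d ≡ 1ℚ
n/n≡1 d = ℚ.toℚᵘ-injective (ℚᵘ.≃-trans (ℚ.toℚᵘ-fromℚᵘ (ℚᵘ.mkℚᵘ (+ suc d) d))
  (ℚᵘ.*≡* (ℤ.*-comm (+ suc d) (+ 1))))

/-suc-< : ∀ a d → + suc a / suc (suc d) ℚ.< + suc a / suc d
/-suc-< a d = ℚ.toℚᵘ-cancel-< (begin-strict
  ℚ.toℚᵘ (+ suc a / suc (suc d))  ≃⟨ ℚ.toℚᵘ-fromℚᵘ (ℚᵘ.mkℚᵘ (+ suc a) (suc d)) ⟩
  ℚᵘ.mkℚᵘ (+ suc a) (suc d)       <⟨ ℚᵘ.*<* (ℤ.*-monoˡ-<-pos (+ suc a) (ℤ.+<+ (ℕ.n<1+n (suc d)))) ⟩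
  ℚᵘ.mkℚᵘ (+ suc a) d             ≃⟨ ℚ.toℚᵘ-fromℚᵘ (ℚᵘ.mkℚᵘ (+ suc a) d) ⟨
  ℚ.toℚᵘ (+ suc a / suc d)        ∎)
  where open ℚᵘ.≤-Reasoning

abstract
  -- The probability that at most k of d given elements precede a further one in a
  -- uniformly random ordering.
  prob : ℕ → ℕ → ℚ
  prob k d = + (suc k ℕ.⊓ suc d) / suc d

  prob-≤ : ∀ {k d} → k ℕ.≤ d → prob k d ≡ + suc k / suc d
  prob-≤ {k} {d} k≤d = cong (λ a → + a / suc d) (ℕ.m≤n⇒m⊓n≡m (s≤s k≤d))

  prob-≥ : ∀ {k d} → d ℕ.≤ k → prob k d ≡ 1ℚ
  prob-≥ {k} {d} d≤k = trans (cong (λ a → + a / suc d) (ℕ.m≥n⇒m⊓n≡n (s≤s d≤k))) (n/n≡1 d)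

  0≤prob : ∀ k d → 0ℚ ℚ.≤ prob k d
  0≤prob k d = ℚ.nonNegative⁻¹ (prob k d) {{ℚ.normalize-nonNeg (suc k ℕ.⊓ suc d) (suc d)}}

-- For `k ≤ d` the truncation in `prob` is inactive on both sides, and only the denominator grows.
-- This strictness is what makes saturation spread along edges.
prob-suc-< : ∀ {k d} → k ℕ.≤ d → prob k (suc d) ℚ.< prob k d
prob-suc-< {k} {d} k≤d = subst₂ ℚ._<_ (sym (prob-≤ (ℕ.m≤n⇒m≤1+n k≤d))) (sym (prob-≤ k≤d)) (/-suc-< k d)

prob-suc-≤ : ∀ k d → prob k (suc d) ℚ.≤ prob k d
prob-suc-≤ k d with ℕ.≤-<-connex k d
... | inj₁ k≤d = ℚ.<⇒≤ (prob-suc-< k≤d)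
... | inj₂ d<k = ℚ.≤-reflexive (trans (prob-≥ d<k) (sym (prob-≥ (ℕ.<⇒≤ d<k))))

-- Conditioning on which of the d + 1 elements comes last.
prob-rec : ∀ k d → ι (suc d) ℚ.* prob k d ≡ when (d ℕ.≤? k) 1ℚ ℚ.+ ι d ℚ.* prob k (ℕ.pred d)
-- The default `ℕ.pred 0` is harmless: its probability is multiplied by `ι 0`.
prob-rec k zero    = trans (cong (ι 1 ℚ.*_) (prob-≥ {k} z≤n)) (sym (trans (cong (1ℚ ℚ.+_) (ℚ.*-zeroˡ (prob k 0))) (ℚ.+-identityʳ 1ℚ)))
prob-rec k (suc d) with ℕ.≤-<-connex (suc d) k
... | inj₁ d<k = trans (cong (ι (suc (suc d)) ℚ.*_) (prob-≥ d<k)) (trans (ℚ.*-identityʳ _)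
  (sym (cong₂ ℚ._+_ (when-true (suc d ℕ.≤? k) d<k)
    (trans (cong (ι (suc d) ℚ.*_) (prob-≥ (ℕ.<⇒≤ d<k))) (ℚ.*-identityʳ (ι (suc d)))))))
... | inj₂ k<1+d@(s≤s k≤d) = trans (cong (ι (suc (suc d)) ℚ.*_) (prob-≤ (ℕ.<⇒≤ k<1+d)))
  (trans (ι-suc-*-/ (suc k) (suc d))
  (sym (trans (cong₂ ℚ._+_ (when-false (suc d ℕ.≤? k) (ℕ.<⇒≱ k<1+d))
    (trans (cong (ι (suc d) ℚ.*_) (prob-≤ k≤d)) (ι-suc-*-/ (suc k) d)))
    (ℚ.+-identityˡ (ι (suc k))))))

-- Subsets and degrees

module _ {n : ℕ} {P : Pred (Fin n) 0ℓ} (P? : Decidable P) where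

  ∈-comprehension⁺ : ∀ {x} → P x → x ∈ comprehension P?
  ∈-comprehension⁺ {x} px = lookup⇒[]= x (comprehension P?)
    (trans (lookup∘tabulate (does ∘ P?) x) (dec-true (P? x) px))

  ∈-comprehension⁻ : ∀ {x} → x ∈ comprehension P? → P x
  ∈-comprehension⁻ {x} x∈ with P? x | trans (sym (lookup∘tabulate (does ∘ P?) x)) ([]=⇒lookup x∈)
  ... | yes px | _ = px
  ... | no _   | ()

∩-remove : ∀ {n} (p q : Subset n) x → p ∩ (q - x) ≡ (p ∩ q) - x
∩-remove p q x = ⊆-antisym
  (λ z∈ → let z∈p , z∈q-x = x∈p∩q⁻ p (q - x) z∈ in
    x∈p∧x≢y⇒x∈p-y (x∈p∩q⁺ (z∈p , x∈p-y⇒x∈p q x z∈q-x)) (x∈p-y⇒x≢y q z∈q-x))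
  (λ z∈ → let z∈p , z∈q = x∈p∩q⁻ p q (x∈p-y⇒x∈p (p ∩ q) x z∈) in
    x∈p∩q⁺ (z∈p , x∈p∧x≢y⇒x∈p-y z∈q (x∈p-y⇒x≢y (p ∩ q) z∈)))

x∉p⇒p-x≡p : ∀ {n} {x : Fin n} (p : Subset n) → x ∉ p → p - x ≡ p
x∉p⇒p-x≡p {x = x} p x∉p = ⊆-antisym (x∈p-y⇒x∈p p x)
  (λ z∈p → x∈p∧x≢y⇒x∈p-y z∈p (λ { refl → x∉p z∈p }))

[⁅x⁆∪p]-x≡p : ∀ {n} {x : Fin n} (p : Subset n) → x ∉ p → (⁅ x ⁆ ∪ p) - x ≡ p
[⁅x⁆∪p]-x≡p {x = x} p x∉p = ⊆-antisym
  (λ z∈ → case x∈p∪q⁻ ⁅ x ⁆ p (x∈p-y⇒x∈p (⁅ x ⁆ ∪ p) x z∈) of λ where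
    (inj₁ z∈⁅x⁆) → contradiction (x∈⁅y⁆⇒x≡y x z∈⁅x⁆) (x∈p-y⇒x≢y (⁅ x ⁆ ∪ p) z∈)
    (inj₂ z∈p)   → z∈p)
  (λ z∈p → x∈p∧x≢y⇒x∈p-y (x∈p∪q⁺ (inj₂ z∈p)) (λ { refl → x∉p z∈p }))

x∈⁅x⁆∪p : ∀ {n} (x : Fin n) p → x ∈ ⁅ x ⁆ ∪ p
x∈⁅x⁆∪p x p = x∈p∪q⁺ (inj₁ (x∈⁅x⁆ x))

module _ {A : Set} where

  lookup-∷ʳ-inject₁ : ∀ {k} (xs : Vec A k) y i → lookup (xs ∷ʳ y) (inject₁ i) ≡ lookup xs i
  lookup-∷ʳ-inject₁ (x ∷ xs) y zero    = refl
  lookup-∷ʳ-inject₁ (x ∷ xs) y (suc i) = lookup-∷ʳ-inject₁ xs y i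

  lookup-∷ʳ-fromℕ : ∀ {k} (xs : Vec A k) y → lookup (xs ∷ʳ y) (fromℕ k) ≡ y
  lookup-∷ʳ-fromℕ []       y = refl
  lookup-∷ʳ-fromℕ (x ∷ xs) y = lookup-∷ʳ-fromℕ xs y

module _ {n : ℕ} (G : Graph n) where
  open Graph G

  ∈-neighbours⁺ : ∀ {u v} → Adj u v → v ∈ neighbours G u
  ∈-neighbours⁺ {u} = ∈-comprehension⁺ (adj? u)

  ∈-neighbours⁻ : ∀ {u v} → v ∈ neighbours G u → Adj u v
  ∈-neighbours⁻ {u} = ∈-comprehension⁻ (adj? u)

  degreeIn : Subset n → Fin n → ℕ
  degreeIn S u = ∣ neighbours G u ∩ S ∣

  degreeIn-⊤ : ∀ u → degreeIn ⊤ u ≡ degree G u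
  degreeIn-⊤ u = cong ∣_∣ (∩-identityʳ (neighbours G u))

  degreeIn-mono : ∀ {S T} u → S ⊆ T → degreeIn S u ℕ.≤ degreeIn T u
  degreeIn-mono {S} {T} u S⊆T = p⊆q⇒∣p∣≤∣q∣ λ x∈ →
    let x∈N , x∈S = x∈p∩q⁻ (neighbours G u) S x∈ in x∈p∩q⁺ (x∈N , S⊆T x∈S)

  degreeIn-remove-adj : ∀ {S u v} → Adj u v → v ∈ S → suc (degreeIn (S - v) u) ≡ degreeIn S u
  degreeIn-remove-adj {S} {u} {v} u~v v∈S = trans
    (cong (suc ∘ ∣_∣) (∩-remove (neighbours G u) S v))
    (x∈p⇒1+∣p-x∣≡∣p∣ (neighbours G u ∩ S) (x∈p∩q⁺ (∈-neighbours⁺ u~v , v∈S)))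

  degreeIn-remove-¬adj : ∀ {S u v} → ¬ Adj u v → degreeIn (S - v) u ≡ degreeIn S u
  degreeIn-remove-¬adj {S} {u} {v} u≁v = trans
    (cong ∣_∣ (∩-remove (neighbours G u) S v))
    (cong ∣_∣ (x∉p⇒p-x≡p (neighbours G u ∩ S) λ v∈ →
      u≁v (∈-neighbours⁻ (proj₁ (x∈p∩q⁻ (neighbours G u) S v∈)))))

  degreeIn<∣S∣ : ∀ {S u} → u ∈ S → degreeIn S u ℕ.< ∣ S ∣
  degreeIn<∣S∣ {S} {u} u∈S = subst (degreeIn S u ℕ.<_) (x∈p⇒1+∣p-x∣≡∣p∣ S u∈S)
    (s≤s (p⊆q⇒∣p∣≤∣q∣ {q = S - u} λ x∈ →
      let x∈N , x∈S = x∈p∩q⁻ (neighbours G u) S x∈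
      in x∈p∧x≢y⇒x∈p-y x∈S λ { refl → adj-irrefl u (∈-neighbours⁻ x∈N) }))

-- Building degenerate sets

module _ {n : ℕ} (G : Graph n) (κ : Fin n → ℤ) where

  degenerate-⊥ : Degenerate G κ ⊥
  degenerate-⊥ = 0 , [] , record
    { distinct = λ { {()} } ; enumerates = λ v → mk⇔ (λ v∈⊥ → contradiction v∈⊥ ∉⊥) (λ { (() , _) }) ; bound = λ () }

  -- With `v` placed at the end, no old vertex gains a predecessor, and all predecessors of `v` lie
  -- in `I`.
  degenerate-extend : ∀ {I v} → Degenerate G κ I → v ∉ I → + degreeIn G I v ℤ.≤ κ v →
                      Degenerate G κ (⁅ v ⁆ ∪ I)
  degenerate-extend {I} {v} (k , us , o) v∉I bound-v = suc k , us ∷ʳ v , record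
    { distinct = λ {i} {j} → distinct′ i j ; enumerates = λ w → mk⇔ to from ; bound = bound′ }
    where
    open IsDegenerateOrdering o
    old : ∀ i → lookup (us ∷ʳ v) (inject₁ i) ≡ lookup us i
    old = lookup-∷ʳ-inject₁ us v
    new : lookup (us ∷ʳ v) (fromℕ k) ≡ v
    new = lookup-∷ʳ-fromℕ us v
    lookup∈I : ∀ i → lookup us i ∈ I
    lookup∈I i = Equivalence.from (enumerates (lookup us i)) (i , refl)

    distinct′ : ∀ i j → lookup (us ∷ʳ v) i ≡ lookup (us ∷ʳ v) j → i ≡ j
    distinct′ i j eq with view i | view j
    ... | ‵fromℕ     | ‵fromℕ     = refl
    ... | ‵fromℕ     | ‵inject₁ j = contradiction (subst (_∈ I) (trans (sym (old j)) (trans (sym eq) new)) (lookup∈I j)) v∉I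
    ... | ‵inject₁ i | ‵fromℕ     = contradiction (subst (_∈ I) (trans (sym (old i)) (trans eq new)) (lookup∈I i)) v∉I
    ... | ‵inject₁ i | ‵inject₁ j = cong inject₁ (distinct (trans (sym (old i)) (trans eq (old j))))

    to : ∀ {w} → w ∈ ⁅ v ⁆ ∪ I → ∃ λ i → lookup (us ∷ʳ v) i ≡ w
    to {w} w∈ with x∈p∪q⁻ ⁅ v ⁆ I w∈
    ... | inj₁ w∈⁅v⁆ = fromℕ k , trans new (sym (x∈⁅y⁆⇒x≡y v w∈⁅v⁆))
    ... | inj₂ w∈I with Equivalence.to (enumerates w) w∈I
    ...   | i , eq = inject₁ i , trans (old i) eq

    from : ∀ {w} → (∃ λ i → lookup (us ∷ʳ v) i ≡ w) → w ∈ ⁅ v ⁆ ∪ I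
    from (i , refl) with view i
    ... | ‵fromℕ     = subst (_∈ ⁅ v ⁆ ∪ I) (sym new) (x∈⁅x⁆∪p v I)
    ... | ‵inject₁ i = subst (_∈ ⁅ v ⁆ ∪ I) (sym (old i)) (x∈p∪q⁺ (inj₂ (lookup∈I i)))

    bound′ : ∀ i → + ∣ neighbours G (lookup (us ∷ʳ v) i) ∩ predecessors (us ∷ʳ v) i ∣ ℤ.≤ κ (lookup (us ∷ʳ v) i)
    bound′ i with view i
    ... | ‵fromℕ = subst (λ w → + degreeIn G (predecessors (us ∷ʳ v) (fromℕ k)) w ℤ.≤ κ w) (sym new)
      (ℤ.≤-trans (ℤ.+≤+ (degreeIn-mono G v preds⊆I)) bound-v)
      where
      preds⊆I : predecessors (us ∷ʳ v) (fromℕ k) ⊆ I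
      preds⊆I x∈ with ∈-comprehension⁻ (precedes? (us ∷ʳ v) (fromℕ k)) x∈
      ... | j , j<k , refl with view j
      ...   | ‵fromℕ     = contradiction j<k (ℕ.<-irrefl refl)
      ...   | ‵inject₁ j = subst (_∈ I) (sym (old j)) (lookup∈I j)
    ... | ‵inject₁ i = subst (λ w → + degreeIn G (predecessors (us ∷ʳ v) (inject₁ i)) w ℤ.≤ κ w) (sym (old i))
      (ℤ.≤-trans (ℤ.+≤+ (degreeIn-mono G (lookup us i) preds⊆preds)) (bound i))
      where
      preds⊆preds : predecessors (us ∷ʳ v) (inject₁ i) ⊆ predecessors us i
      preds⊆preds x∈ with ∈-comprehension⁻ (precedes? (us ∷ʳ v) (inject₁ i)) x∈
      ... | j , j<i , refl with view j
      ...   | ‵fromℕ     = contradiction (ℕ.<-≤-trans j<i (ℕ.≤-trans (ℕ.≤-reflexive (Fin.toℕ-inject₁ i)) (ℕ.<⇒≤ (Fin.toℕ<n i))))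
                             (ℕ.<-irrefl (Fin.toℕ-fromℕ k))
      ...   | ‵inject₁ j = ∈-comprehension⁺ (precedes? us i)
        (j , subst₂ ℕ._<_ (Fin.toℕ-inject₁ j) (Fin.toℕ-inject₁ i) j<i , sym (old j))

-- Expected weights and conditioning on the last vertex

module _ {n : ℕ} (G : Graph n) (k : Fin n → ℕ) (c : Fin n → ℚ) where
  open Graph G

  -- E(S), by linearity of expectation: `u` is kept when at most `k u` of its neighbours in `S`
  -- precede it.
  expected : Subset n → ℚ
  expected S = sumOn S (λ u → c u ℚ.* prob (k u) (degreeIn G S u))

  -- A last vertex is preceded by all its neighbours in `S`, so whether it is kept is no longer
  -- random.
  gain : Subset n → Fin n → ℚ
  gain S v = when (degreeIn G S v ℕ.≤? k v) (c v)

  -- The conditional expectation given that v is the last vertex of S.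
  expectedLast : Subset n → Fin n → ℚ
  expectedLast S v = gain S v ℚ.+ expected (S - v)

  -- The law of total probability, multiplied by `∣ S ∣`. After the two sums are exchanged the
  -- identity holds for each `u` separately: deleting a non-neighbour leaves the term of `u`
  -- unchanged, and the remaining cases add up by `prob-rec`.
  average : ∀ S → sumOn S (expectedLast S) ≡ ι ∣ S ∣ ℚ.* expected S
  average S = begin
    sumOn S (expectedLast S)
      ≡⟨ sumOn-+ S (gain S) (λ v → expected (S - v)) ⟩
    sumOn S (gain S) ℚ.+ sumOn S (λ v → expected (S - v))
      ≡⟨ cong (sumOn S (gain S) ℚ.+_) (trans
           (sum-cong-≗ λ v → when-sum (v ∈? S) (λ u → when (u ∈? S - v) (term v u)))
           (∑-comm λ v u → when (v ∈? S) (when (u ∈? S - v) (term v u)))) ⟩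
    sumOn S (gain S) ℚ.+ sum column
      ≡⟨ ∑-distrib-+ (λ u → when (u ∈? S) (gain S u)) column ⟨
    sum (λ u → when (u ∈? S) (gain S u) ℚ.+ column u)
      ≡⟨ sum-cong-≗ columns ⟩
    sum (λ u → ι ∣ S ∣ ℚ.* when (u ∈? S) (c u ℚ.* prob (k u) (degreeIn G S u)))
      ≡⟨ *-distribˡ-sum (ι ∣ S ∣) (λ u → when (u ∈? S) (c u ℚ.* prob (k u) (degreeIn G S u))) ⟨
    ι ∣ S ∣ ℚ.* expected S ∎
    where
    open ≡-Reasoning
    term : Fin n → Fin n → ℚ
    term v u = c u ℚ.* prob (k u) (degreeIn G (S - v) u)
    column : Fin n → ℚ
    column u = sum (λ v → when (v ∈? S) (when (u ∈? S - v) (term v u)))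

    column-∉ : ∀ {u} → u ∉ S → column u ≡ 0ℚ
    column-∉ {u} u∉S = trans (sum-cong-≗ λ v → trans
      (when-cong (v ∈? S) {y = 0ℚ} (λ _ → when-false (u ∈? S - v) (u∉S ∘ x∈p-y⇒x∈p S v)))
      (zeros v)) (sum-replicate-zero n)
      where
      zeros : ∀ v → when (v ∈? S) 0ℚ ≡ 0ℚ
      zeros v with does (v ∈? S)
      ... | true  = refl
      ... | false = refl

    module _ {u} (u∈S : u ∈ S) where
      d = degreeIn G S u
      N = neighbours G u
      X Y : ℚ
      X = c u ℚ.* prob (k u) d
      Y = c u ℚ.* prob (k u) (ℕ.pred d)

      u∉N∩S : u ∉ N ∩ S
      u∉N∩S u∈ = adj-irrefl u (∈-neighbours⁻ G (proj₁ (x∈p∩q⁻ N S u∈)))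

      -- The deletion of `u` contributes nothing, that of a neighbour contributes `Y`, and any other
      -- deletion within `S` contributes `X`. The missing copies of `X` are added on the left so
      -- that no subtraction occurs.
      entry : ∀ v → when (v ∈? S) (when (u ∈? S - v) (term v u)) ℚ.+ (when (v ∈? ⁅ u ⁆) X ℚ.+ when (v ∈? N ∩ S) X)
                  ≡ when (v ∈? S) X ℚ.+ when (v ∈? N ∩ S) Y
      entry v with v Fin.≟ u
      ... | yes refl = begin
        _ ≡⟨ cong₂ ℚ._+_
               (trans (when-true (u ∈? S) u∈S) (when-false (u ∈? S - u) (x∉p-x S)))
               (cong₂ ℚ._+_ (when-true (u ∈? ⁅ u ⁆) (x∈⁅x⁆ u)) (when-false (u ∈? N ∩ S) u∉N∩S)) ⟩
        0ℚ ℚ.+ (X ℚ.+ 0ℚ) ≡⟨ ℚ.+-identityˡ (X ℚ.+ 0ℚ) ⟩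
        X ℚ.+ 0ℚ ≡⟨ cong₂ ℚ._+_ (when-true (u ∈? S) u∈S) (when-false (u ∈? N ∩ S) u∉N∩S) ⟨
        _ ∎
      ... | no v≢u = case v ∈? S of λ where
        (no v∉S) → let v∉N∩S = λ v∈ → v∉S (proj₂ (x∈p∩q⁻ N S v∈)) in begin
          _ ≡⟨ cong₂ ℚ._+_ (when-false (v ∈? S) v∉S)
                 (cong₂ ℚ._+_ (when-false (v ∈? ⁅ u ⁆) (x≢y⇒x∉⁅y⁆ v≢u)) (when-false (v ∈? N ∩ S) v∉N∩S)) ⟩
          0ℚ ℚ.+ 0ℚ ≡⟨ cong₂ ℚ._+_ (when-false (v ∈? S) v∉S) (when-false (v ∈? N ∩ S) v∉N∩S) ⟨
          _ ∎
        (yes v∈S) →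
          let present = trans (when-true (v ∈? S) v∈S) (when-true (u ∈? S - v) (x∈p∧x≢y⇒x∈p-y u∈S (v≢u ∘ sym)))
          in case adj? u v of λ where
          (yes u~v) → let v∈N∩S = x∈p∩q⁺ (∈-neighbours⁺ G u~v , v∈S) in begin
            _ ≡⟨ cong₂ ℚ._+_
                   (trans present (cong (λ d → c u ℚ.* prob (k u) d) (cong ℕ.pred (degreeIn-remove-adj G u~v v∈S))))
                   (cong₂ ℚ._+_ (when-false (v ∈? ⁅ u ⁆) (x≢y⇒x∉⁅y⁆ v≢u)) (when-true (v ∈? N ∩ S) v∈N∩S)) ⟩
            Y ℚ.+ (0ℚ ℚ.+ X) ≡⟨ cong (Y ℚ.+_) (ℚ.+-identityˡ X) ⟩
            Y ℚ.+ X          ≡⟨ ℚ.+-comm Y X ⟩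
            X ℚ.+ Y          ≡⟨ cong₂ ℚ._+_ (when-true (v ∈? S) v∈S) (when-true (v ∈? N ∩ S) v∈N∩S) ⟨
            _ ∎
          (no u≁v) → let v∉N∩S = λ v∈ → u≁v (∈-neighbours⁻ G (proj₁ (x∈p∩q⁻ N S v∈))) in begin
            _ ≡⟨ cong₂ ℚ._+_
                   (trans present (cong (λ d → c u ℚ.* prob (k u) d) (degreeIn-remove-¬adj G u≁v)))
                   (cong₂ ℚ._+_ (when-false (v ∈? ⁅ u ⁆) (x≢y⇒x∉⁅y⁆ v≢u)) (when-false (v ∈? N ∩ S) v∉N∩S)) ⟩
            X ℚ.+ 0ℚ ≡⟨ cong₂ ℚ._+_ (when-true (v ∈? S) v∈S) (when-false (v ∈? N ∩ S) v∉N∩S) ⟨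
            _ ∎

      column-sum : column u ℚ.+ (X ℚ.+ ι d ℚ.* X) ≡ ι ∣ S ∣ ℚ.* X ℚ.+ ι d ℚ.* Y
      column-sum = begin
        column u ℚ.+ (X ℚ.+ ι d ℚ.* X)
          ≡⟨ cong (column u ℚ.+_) (cong₂ ℚ._+_ (sumOn-⁅⁆ u X) (sumOn-const (N ∩ S) X)) ⟨
        column u ℚ.+ (sumOn ⁅ u ⁆ (λ _ → X) ℚ.+ sumOn (N ∩ S) (λ _ → X))
          ≡⟨ cong (column u ℚ.+_) (∑-distrib-+ (λ v → when (v ∈? ⁅ u ⁆) X) (λ v → when (v ∈? N ∩ S) X)) ⟨
        column u ℚ.+ sum (λ v → when (v ∈? ⁅ u ⁆) X ℚ.+ when (v ∈? N ∩ S) X)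
          ≡⟨ ∑-distrib-+ (λ v → when (v ∈? S) (when (u ∈? S - v) (term v u))) (λ v → when (v ∈? ⁅ u ⁆) X ℚ.+ when (v ∈? N ∩ S) X) ⟨
        sum (λ v → when (v ∈? S) (when (u ∈? S - v) (term v u)) ℚ.+ (when (v ∈? ⁅ u ⁆) X ℚ.+ when (v ∈? N ∩ S) X))
          ≡⟨ sum-cong-≗ entry ⟩
        sum (λ v → when (v ∈? S) X ℚ.+ when (v ∈? N ∩ S) Y)
          ≡⟨ ∑-distrib-+ (λ v → when (v ∈? S) X) (λ v → when (v ∈? N ∩ S) Y) ⟩
        sumOn S (λ _ → X) ℚ.+ sumOn (N ∩ S) (λ _ → Y)
          ≡⟨ cong₂ ℚ._+_ (sumOn-const S X) (sumOn-const (N ∩ S) Y) ⟩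
        ι ∣ S ∣ ℚ.* X ℚ.+ ι d ℚ.* Y ∎

      gain-* : gain S u ≡ c u ℚ.* when (d ℕ.≤? k u) 1ℚ
      gain-* with does (d ℕ.≤? k u)
      ... | true  = sym (ℚ.*-identityʳ (c u))
      ... | false = sym (ℚ.*-zeroʳ (c u))

      gain-balance : gain S u ℚ.+ ι d ℚ.* Y ≡ X ℚ.+ ι d ℚ.* X
      gain-balance = begin
        gain S u ℚ.+ ι d ℚ.* (c u ℚ.* prob (k u) (ℕ.pred d))
          ≡⟨ cong (ℚ._+ ι d ℚ.* Y) gain-* ⟩
        c u ℚ.* when (d ℕ.≤? k u) 1ℚ ℚ.+ ι d ℚ.* (c u ℚ.* prob (k u) (ℕ.pred d))
          ≡⟨ solve 4 (λ c w i q → c :* w :+ i :* (c :* q) := c :* (w :+ i :* q)) refl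
               (c u) (when (d ℕ.≤? k u) 1ℚ) (ι d) (prob (k u) (ℕ.pred d)) ⟩
        c u ℚ.* (when (d ℕ.≤? k u) 1ℚ ℚ.+ ι d ℚ.* prob (k u) (ℕ.pred d))
          ≡⟨ cong (c u ℚ.*_) (prob-rec (k u) d) ⟨
        c u ℚ.* (ι (suc d) ℚ.* prob (k u) d)
          ≡⟨ solve 3 (λ c i p → c :* ((con 1ℚ :+ i) :* p) := c :* p :+ i :* (c :* p)) refl (c u) (ι d) (prob (k u) d) ⟩
        X ℚ.+ ι d ℚ.* X ∎

      column-∈ : gain S u ℚ.+ column u ≡ ι ∣ S ∣ ℚ.* X
      column-∈ = begin
        gain S u ℚ.+ column u
          -- The sum `X ℚ.+ ι d ℚ.* X` occurs in both `column-sum` and `gain-balance`, and is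
          -- eliminated between them.
          ≡⟨ solve 3 (λ a b z → a :+ b := (b :+ z) :+ (a :- z)) refl (gain S u) (column u) (X ℚ.+ ι d ℚ.* X) ⟩
        (column u ℚ.+ (X ℚ.+ ι d ℚ.* X)) ℚ.+ (gain S u ℚ.- (X ℚ.+ ι d ℚ.* X))
          ≡⟨ cong (ℚ._+ (gain S u ℚ.- (X ℚ.+ ι d ℚ.* X))) column-sum ⟩
        (ι ∣ S ∣ ℚ.* X ℚ.+ ι d ℚ.* Y) ℚ.+ (gain S u ℚ.- (X ℚ.+ ι d ℚ.* X))
          ≡⟨ cong (λ z → (ι ∣ S ∣ ℚ.* X ℚ.+ ι d ℚ.* Y) ℚ.+ (gain S u ℚ.- z)) gain-balance ⟨
        (ι ∣ S ∣ ℚ.* X ℚ.+ ι d ℚ.* Y) ℚ.+ (gain S u ℚ.- (gain S u ℚ.+ ι d ℚ.* Y))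
          ≡⟨ solve 3 (λ x y a → (x :+ y) :+ (a :- (a :+ y)) := x) refl (ι ∣ S ∣ ℚ.* X) (ι d ℚ.* Y) (gain S u) ⟩
        ι ∣ S ∣ ℚ.* X ∎

    columns : ∀ u → when (u ∈? S) (gain S u) ℚ.+ column u
                  ≡ ι ∣ S ∣ ℚ.* when (u ∈? S) (c u ℚ.* prob (k u) (degreeIn G S u))
    columns u = case u ∈? S of λ where
      (yes u∈S) → trans (cong (ℚ._+ column u) (when-true (u ∈? S) u∈S))
        (trans (column-∈ u∈S) (cong (ι ∣ S ∣ ℚ.*_) (sym (when-true (u ∈? S) u∈S))))
      (no u∉S)  → trans (cong₂ ℚ._+_ (when-false (u ∈? S) u∉S) (column-∉ u∉S))
        (trans (sym (ℚ.*-zeroʳ (ι ∣ S ∣))) (cong (ι ∣ S ∣ ℚ.*_) (sym (when-false (u ∈? S) u∉S))))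

-- Near-equality and its inheritance by subsets

module _ (n : ℕ) where

  ε≤ι[1+n]*ε : ∀ {ε} → 0ℚ ℚ.≤ ε → ε ℚ.≤ ι (suc n) ℚ.* ε
  ε≤ι[1+n]*ε {ε} 0≤ε = subst (ε ℚ.≤_) (solve 2 (λ i ε → ε :+ i :* ε := (con 1ℚ :+ i) :* ε) refl (ι n) ε)
    (p≤p+q (0≤p*q (0≤ι n) 0≤ε))

  -- Multiplication by the `j`-th power of n + 1: each deletion of a vertex costs one such factor in
  -- the error.
  scale : ℕ → ℚ → ℚ
  scale zero    ε = ε
  scale (suc j) ε = ι (suc n) ℚ.* scale j ε

  0≤scale : ∀ j {ε} → 0ℚ ℚ.≤ ε → 0ℚ ℚ.≤ scale j ε
  0≤scale zero    0≤ε = 0≤ε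
  0≤scale (suc j) 0≤ε = 0≤p*q (0≤ι (suc n)) (0≤scale j 0≤ε)

  scale-small : ∀ j η → 0ℚ ℚ.< η → ∃ λ ε → 0ℚ ℚ.< ε × scale j ε ℚ.≤ η
  scale-small zero    η 0<η = η , 0<η , ℚ.≤-refl
  scale-small (suc j) η 0<η with shrink (ι (suc n)) η (0≤ι (suc n)) 0<η
  ... | δ , 0<δ , small with scale-small j δ 0<δ
  ... | ε , 0<ε , ≤δ = ε , 0<ε , ℚ.≤-trans (*-monoˡ-≤ (0≤ι (suc n)) ≤δ) (ℚ.<⇒≤ small)

-- Every term of the average equals E(S) up to `ε`, for all `S` at once. This is the form in which
-- equality enters the structural argument.
Stable : ∀ {n} → Graph n → (Fin n → ℕ) → (Fin n → ℚ) → ℚ → Set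
Stable G k c ε = ∀ {S v} → v ∈ S →
  expectedLast G k c S v ℚ.≤ expected G k c S ℚ.+ ε × expected G k c S ℚ.≤ expectedLast G k c S v ℚ.+ ε

module _ {n : ℕ} (G : Graph n) (κ : Fin n → ℤ) (k : Fin n → ℕ) (κ≡+k : ∀ u → κ u ≡ + k u) (c : Fin n → ℚ) where
  open Graph G

  private
    E = expected G k c
    L = expectedLast G k c

  -- Otherwise all terms lie below `E S`, strictly so at `w`, and their sum contradicts `average`.
  last-above-average : ∀ S → Nonempty S → ∃ λ v → v ∈ S × E S ℚ.≤ L S v
  last-above-average S (w , w∈S) with Fin.any? (λ v → (v ∈? S) ×-dec (E S ℚ.≤? L S v))
  ... | yes found = found
  ... | no none   = contradiction (trans (average G k c S) (sym (sumOn-const S (E S))))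
    (ℚ.<⇒≢ (sum-< (λ u → when-mono (u ∈? S) (λ u∈S → ℚ.<⇒≤ (below u∈S))) w
      (subst₂ ℚ._<_ (sym (when-true (w ∈? S) w∈S)) (sym (when-true (w ∈? S) w∈S)) (below w∈S))))
    where
    below : ∀ {v} → v ∈ S → L S v ℚ.< E S
    below {v} v∈S = ℚ.≰⇒> λ E≤L → none (v , v∈S , E≤L)

  -- A `v` saturated in `S` is appended to `I`, where its degree is no larger than in `S`; an
  -- unsaturated `v` is left out. Either way the weight grows by exactly the gain.
  degenerate-append : ∀ {S I v} → v ∈ S → I ⊆ S - v → Degenerate G κ I →
    ∃ λ J → J ⊆ S × Degenerate G κ J × sumOn J c ≡ gain G k c S v ℚ.+ sumOn I c
  degenerate-append {S} {I} {v} v∈S I⊆S-v deg-I with degreeIn G S v ℕ.≤? k v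
  ... | yes d≤k = ⁅ v ⁆ ∪ I , J⊆S , degenerate-extend G κ deg-I v∉I bound , weight-J
    where
    v∉I : v ∉ I
    v∉I v∈I = x∉p-x S (I⊆S-v v∈I)
    I⊆S : I ⊆ S
    I⊆S x∈I = x∈p-y⇒x∈p S v (I⊆S-v x∈I)
    J⊆S : ⁅ v ⁆ ∪ I ⊆ S
    J⊆S x∈ with x∈p∪q⁻ ⁅ v ⁆ I x∈
    ... | inj₁ x∈⁅v⁆ = subst (_∈ S) (sym (x∈⁅y⁆⇒x≡y v x∈⁅v⁆)) v∈S
    ... | inj₂ x∈I   = I⊆S x∈I
    bound : + degreeIn G I v ℤ.≤ κ v
    bound = subst (+ degreeIn G I v ℤ.≤_) (sym (κ≡+k v)) (ℤ.+≤+ (ℕ.≤-trans (degreeIn-mono G v I⊆S) d≤k))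
    weight-J : sumOn (⁅ v ⁆ ∪ I) c ≡ gain G k c S v ℚ.+ sumOn I c
    weight-J = trans (sumOn-remove (⁅ v ⁆ ∪ I) (x∈⁅x⁆∪p v I) c)
      (cong₂ ℚ._+_ (sym (when-true (degreeIn G S v ℕ.≤? k v) d≤k))
        (cong (λ T → sumOn T c) ([⁅x⁆∪p]-x≡p I v∉I)))
  ... | no d≰k = I , (λ x∈I → x∈p-y⇒x∈p S v (I⊆S-v x∈I)) , deg-I , sym (trans
    (cong (ℚ._+ sumOn I c) (when-false (degreeIn G S v ℕ.≤? k v) d≰k)) (ℚ.+-identityˡ (sumOn I c)))

  -- Derandomisation by conditional expectations: fix a last vertex whose term is at least `E S`,
  -- and recurse on the rest. In `go`, the number `m` bounds the size of `S` and makes the recursion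
  -- structural.
  degenerate-above-expected : ∀ S → ∃ λ I → I ⊆ S × Degenerate G κ I × E S ℚ.≤ sumOn I c
  degenerate-above-expected S = go ∣ S ∣ S ℕ.≤-refl
    where
    go : ∀ m S → ∣ S ∣ ℕ.≤ m → ∃ λ I → I ⊆ S × Degenerate G κ I × E S ℚ.≤ sumOn I c
    go m S ∣S∣≤m with nonempty? S
    ... | no empty = ⊥ , ⊥⊆ , degenerate-⊥ G κ , ℚ.≤-reflexive (trans
      (sumOn-cong S (λ u∈S → contradiction (_ , u∈S) empty)) (cong (λ T → sumOn T c) (Empty-unique empty)))
    go zero S ∣S∣≤0 | yes (v , v∈S) = contradiction (ℕ.<-≤-trans (x∈p⇒∣p-x∣<∣p∣ v∈S) ∣S∣≤0) λ ()
    go (suc m) S ∣S∣≤1+m | yes nonempty with last-above-average S nonempty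
    ... | v , v∈S , E≤L with go m (S - v) (ℕ.≤-pred (ℕ.<-≤-trans (x∈p⇒∣p-x∣<∣p∣ v∈S) ∣S∣≤1+m))
    ... | I , I⊆S-v , deg-I , E≤I with degenerate-append v∈S I⊆S-v deg-I
    ... | J , J⊆S , deg-J , J≡ = J , J⊆S , deg-J , (begin
      E S                               ≤⟨ E≤L ⟩
      gain G k c S v ℚ.+ E (S - v)      ≤⟨ ℚ.+-monoʳ-≤ (gain G k c S v) E≤I ⟩
      gain G k c S v ℚ.+ sumOn I c      ≡⟨ J≡ ⟨
      sumOn J c                         ∎)
      where open ℚ.≤-Reasoning

  -- E(S) is within `ε` of the optimum for `S`. For `I ⊆ S`, degeneracy in `G` is the same as
  -- degeneracy in the subgraph induced on `S`, so the ambient graph can stay fixed.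
  Tight : Subset n → ℚ → Set
  Tight S ε = ∀ {I} → I ⊆ S → Degenerate G κ I → sumOn I c ℚ.≤ E S ℚ.+ ε

  module _ {S ε} (tight : Tight S ε) where

    -- A set for `S - v` of weight at least its expectation, extended by `v` where possible, is a
    -- competitor in `S` of weight at least `L S v`.
    tight⇒last≤expected : ∀ {v} → v ∈ S → L S v ℚ.≤ E S ℚ.+ ε
    tight⇒last≤expected {v} v∈S with degenerate-above-expected (S - v)
    ... | I , I⊆S-v , deg-I , E≤I with degenerate-append v∈S I⊆S-v deg-I
    ... | J , J⊆S , deg-J , J≡ = begin
      gain G k c S v ℚ.+ E (S - v)  ≤⟨ ℚ.+-monoʳ-≤ (gain G k c S v) E≤I ⟩
      gain G k c S v ℚ.+ sumOn I c  ≡⟨ J≡ ⟨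
      sumOn J c                     ≤⟨ tight J⊆S deg-J ⟩
      E S ℚ.+ ε                     ∎
      where open ℚ.≤-Reasoning

    -- The other terms of the average exceed it by at most ε each.
    tight⇒expected≤last : 0ℚ ℚ.≤ ε → ∀ {v} → v ∈ S → E S ℚ.≤ L S v ℚ.+ ι n ℚ.* ε
    tight⇒expected≤last 0≤ε {v} v∈S = ℚ.≤-trans (+-cancelˡ-≤ (j ℚ.* E S) (begin
      j ℚ.* E S ℚ.+ E S
        ≡⟨ solve 2 (λ j e → j :* e :+ e := (con 1ℚ :+ j) :* e) refl j (E S) ⟩
      ι (suc ∣ S - v ∣) ℚ.* E S
        ≡⟨ cong (λ m → ι m ℚ.* E S) (x∈p⇒1+∣p-x∣≡∣p∣ S v∈S) ⟩
      ι ∣ S ∣ ℚ.* E S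
        ≡⟨ average G k c S ⟨
      sumOn S (L S)
        ≡⟨ sumOn-remove S v∈S (L S) ⟩
      L S v ℚ.+ sumOn (S - v) (L S)
        ≤⟨ ℚ.+-monoʳ-≤ (L S v) (sumOn-mono (S - v) (λ u∈ → tight⇒last≤expected (x∈p-y⇒x∈p S v u∈))) ⟩
      L S v ℚ.+ sumOn (S - v) (λ _ → E S ℚ.+ ε)
        ≡⟨ cong (L S v ℚ.+_) (sumOn-const (S - v) (E S ℚ.+ ε)) ⟩
      L S v ℚ.+ j ℚ.* (E S ℚ.+ ε)
        ≡⟨ solve 4 (λ l j e ε → l :+ j :* (e :+ ε) := j :* e :+ (l :+ j :* ε)) refl (L S v) j (E S) ε ⟩
      j ℚ.* E S ℚ.+ (L S v ℚ.+ j ℚ.* ε) ∎))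
      (ℚ.+-monoʳ-≤ (L S v) (*-monoʳ-≤ 0≤ε (ι-mono-≤ (∣p∣≤n (S - v)))))
      where
      open ℚ.≤-Reasoning
      j = ι ∣ S - v ∣

    -- Extending a competitor in `S - v` by `v` adds the gain, which also occurs in `L S v` and
    -- cancels. One `ε` comes from the tightness of `S`, and `n` more from comparing `E S` with
    -- `L S v`.
    tight-remove : 0ℚ ℚ.≤ ε → ∀ {v} → v ∈ S → Tight (S - v) (ι (suc n) ℚ.* ε)
    tight-remove 0≤ε {v} v∈S {I} I⊆S-v deg-I with degenerate-append v∈S I⊆S-v deg-I
    ... | J , J⊆S , deg-J , J≡ = +-cancelˡ-≤ (gain G k c S v) (begin
      gain G k c S v ℚ.+ sumOn I c      ≡⟨ J≡ ⟨
      sumOn J c                         ≤⟨ tight J⊆S deg-J ⟩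
      E S ℚ.+ ε                         ≤⟨ ℚ.+-monoˡ-≤ ε (tight⇒expected≤last 0≤ε v∈S) ⟩
      ((gain G k c S v ℚ.+ E (S - v)) ℚ.+ ι n ℚ.* ε) ℚ.+ ε
        ≡⟨ solve 4 (λ g e i ε → ((g :+ e) :+ i :* ε) :+ ε := g :+ (e :+ (con 1ℚ :+ i) :* ε)) refl
             (gain G k c S v) (E (S - v)) (ι n) ε ⟩
      gain G k c S v ℚ.+ (E (S - v) ℚ.+ ι (suc n) ℚ.* ε) ∎)
      where open ℚ.≤-Reasoning

    tight-weaken : ∀ {δ} → ε ℚ.≤ δ → Tight S δ
    tight-weaken ε≤δ I⊆S deg-I = ℚ.≤-trans (tight I⊆S deg-I) (ℚ.+-monoʳ-≤ (E S) ε≤δ)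

  -- The vertices outside `S` are deleted one by one. The index `j` bounds their number; if they run
  -- out before `j` does, the error is merely weakened.
  tight-hereditary : ∀ {ε} → 0ℚ ℚ.≤ ε → Tight ⊤ ε → ∀ S → Tight S (scale n n ε)
  tight-hereditary {ε} 0≤ε tight S = go n S (∣p∣≤n (∁ S))
    where
    go : ∀ j S → ∣ ∁ S ∣ ℕ.≤ j → Tight S (scale n j ε)
    go j S ∣∁S∣≤j with nonempty? (∁ S)
    go zero S ∣∁S∣≤0 | yes (v , v∈∁S) = contradiction (ℕ.<-≤-trans (x∈p⇒∣p-x∣<∣p∣ v∈∁S) ∣∁S∣≤0) λ ()
    go (suc j) S ∣∁S∣≤1+j | yes (v , v∈∁S) = subst (λ T → Tight T (scale n (suc j) ε)) ([⁅x⁆∪p]-x≡p S (x∈∁p⇒x∉p v∈∁S))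
      (tight-remove (go j (⁅ v ⁆ ∪ S) smaller) (0≤scale n j 0≤ε) (x∈⁅x⁆∪p v S))
      where
      smaller : ∣ ∁ (⁅ v ⁆ ∪ S) ∣ ℕ.≤ j
      smaller = ℕ.≤-pred (ℕ.<-≤-trans
        (p⊂q⇒∣p∣<∣q∣ (p⊂q⇒∁p⊃∁q (q⊆p∪q ⁅ v ⁆ S , v , x∈⁅x⁆∪p v S , x∈∁p⇒x∉p v∈∁S))) ∣∁S∣≤1+j)
    go zero S _ | no full = subst (λ T → Tight T ε) (sym (⊆-antisym ⊆⊤ (λ {x} _ → x∉∁p⇒x∈p (λ x∈ → full (x , x∈))))) tight
    go (suc j) S _ | no full = tight-weaken (go j S (ℕ.≤-trans (ℕ.≤-reflexive
        (trans (cong ∣_∣ (Empty-unique full)) (∣⊥∣≡0 n))) z≤n)) (ε≤ι[1+n]*ε n (0≤scale n j 0≤ε))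

  -- The two bounds have errors of 1 and `n` times that of `tight-hereditary`; one further factor n
  -- + 1 covers both.
  tight⇒stable : ∀ {ε} → 0ℚ ℚ.≤ ε → Tight ⊤ ε → Stable G k c (scale n (suc n) ε)
  tight⇒stable {ε} 0≤ε tight {S} {v} v∈S =
    ℚ.≤-trans (tight⇒last≤expected t v∈S) (ℚ.+-monoʳ-≤ (E S) (ε≤ι[1+n]*ε n 0≤δ)) ,
    ℚ.≤-trans (tight⇒expected≤last t 0≤δ v∈S) (ℚ.+-monoʳ-≤ (L S v) (*-monoʳ-≤ 0≤δ (p≤q+p {ι n} (ℚ.<⇒≤ 0<1ℚ))))
    where
    t = tight-hereditary 0≤ε tight S
    0≤δ = 0≤scale n n 0≤ε

-- Saturated vertices

-- Used to choose the leaves of a star: prescribed neighbours, filled up from the neighbourhood to a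
-- prescribed number.
p⊆q∧∣p∣≤j≤∣q∣⇒between : ∀ {n} {p q : Subset n} {j} → p ⊆ q → ∣ p ∣ ℕ.≤ j → j ℕ.≤ ∣ q ∣ →
  ∃ λ r → p ⊆ r × r ⊆ q × ∣ r ∣ ≡ j
p⊆q∧∣p∣≤j≤∣q∣⇒between {p = []} {[]} p⊆q _ z≤n = [] , p⊆q , p⊆q , refl
p⊆q∧∣p∣≤j≤∣q∣⇒between {p = outside ∷ p} {outside ∷ q} p⊆q lo hi
  with p⊆q∧∣p∣≤j≤∣q∣⇒between {p = p} {q} (drop-∷-⊆ p⊆q) lo hi
... | r , p⊆r , r⊆q , eq = outside ∷ r , s⊆s p⊆r , s⊆s r⊆q , eq
p⊆q∧∣p∣≤j≤∣q∣⇒between {p = inside ∷ p} {outside ∷ q} p⊆q lo hi with p⊆q here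
... | ()
p⊆q∧∣p∣≤j≤∣q∣⇒between {p = inside ∷ p} {inside ∷ q} p⊆q (s≤s lo) (s≤s hi)
  with p⊆q∧∣p∣≤j≤∣q∣⇒between {p = p} {q} (drop-∷-⊆ p⊆q) lo hi
... | r , p⊆r , r⊆q , eq = inside ∷ r , s⊆s p⊆r , s⊆s r⊆q , cong suc eq
p⊆q∧∣p∣≤j≤∣q∣⇒between {p = outside ∷ p} {inside ∷ q} {j} p⊆q lo hi with j ℕ.≤? ∣ q ∣
... | no j≰∣q∣ = inside ∷ q , out⊆ (drop-∷-⊆ p⊆q) , ⊆-refl , ℕ.≤-antisym (ℕ.≰⇒> j≰∣q∣) hi
... | yes j≤∣q∣ with p⊆q∧∣p∣≤j≤∣q∣⇒between {p = p} {q} (drop-∷-⊆ p⊆q) lo j≤∣q∣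
...   | r , p⊆r , r⊆q , eq = outside ∷ r , s⊆s p⊆r , out⊆ r⊆q , eq

∣⁅x⁆∪p∣≤1+∣p∣ : ∀ {n} (x : Fin n) p → ∣ ⁅ x ⁆ ∪ p ∣ ℕ.≤ suc ∣ p ∣
∣⁅x⁆∪p∣≤1+∣p∣ x p = ℕ.≤-trans (∣p∣≤1+∣p-x∣ (⁅ x ⁆ ∪ p) x) (s≤s (p⊆q⇒∣p∣≤∣q∣ {q = p} λ z∈ →
  case x∈p∪q⁻ ⁅ x ⁆ p (x∈p-y⇒x∈p (⁅ x ⁆ ∪ p) x z∈) of λ where
    (inj₁ z∈⁅x⁆) → contradiction (x∈⁅y⁆⇒x≡y x z∈⁅x⁆) (x∈p-y⇒x≢y (⁅ x ⁆ ∪ p) z∈)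
    (inj₂ z∈p)   → z∈p))

x∈p⇒0<∣p∣ : ∀ {n} {x : Fin n} {p : Subset n} → x ∈ p → 0 ℕ.< ∣ p ∣
x∈p⇒0<∣p∣ x∈p = ℕ.≤-<-trans z≤n (x∈p⇒∣p-x∣<∣p∣ x∈p)

module _ {n : ℕ} (G : Graph n) (k : Fin n → ℕ) where
  open Graph G

  Saturated : Subset n → Fin n → Set
  Saturated S u = degreeIn G S u ℕ.≤ k u

  AllSaturated : Subset n → Set
  AllSaturated S = ∀ {u} → u ∈ S → Saturated S u

  allSaturated-remove : ∀ {S} v → AllSaturated S → AllSaturated (S - v)
  allSaturated-remove {S} v sat {u} u∈ = ℕ.≤-trans (degreeIn-mono G u (x∈p-y⇒x∈p S v)) (sat (x∈p-y⇒x∈p S v u∈))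

  -- How much likelier `u` is to be kept once one of its neighbours leaves `S`.
  drop : Subset n → Fin n → ℚ
  drop S u = prob (k u) (ℕ.pred (degreeIn G S u)) ℚ.- prob (k u) (degreeIn G S u)

  0<drop : ∀ {S u} → ¬ Saturated S u → 0ℚ ℚ.< drop S u
  0<drop {S} {u} unsat with degreeIn G S u
  ... | zero  = contradiction z≤n unsat
  ... | suc d = p<q⇒0<q-p (prob-suc-< (ℕ.≤-pred (ℕ.≰⇒> unsat)))

  module _ (c : Fin n → ℚ) where

    allSaturated⇒expected : ∀ {S} → AllSaturated S → expected G k c S ≡ sumOn S c
    allSaturated⇒expected {S} sat = sumOn-cong S λ {u} u∈S →
      trans (cong (c u ℚ.*_) (prob-≥ (sat u∈S))) (ℚ.*-identityʳ (c u))

    unsaturated⇒last : ∀ {S v} → ¬ Saturated S v → expectedLast G k c S v ≡ expected G k c (S - v)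
    unsaturated⇒last {S} {v} unsat = trans
      (cong (ℚ._+ expected G k c (S - v)) (when-false (degreeIn G S v ℕ.≤? k v) unsat)) (ℚ.+-identityˡ _)

  module _ {c : Fin n → ℚ} {ε : ℚ} (stable : Stable G k c ε) where

    -- A saturated `v` contributes `c v` both to E(S) and to its own term. Deleting it lowers no
    -- other probability and raises that of its neighbour `u` by the drop, so the term of `v`
    -- exceeds E(S) by at least the left-hand side.
    saturated-drop : (∀ u → 0ℚ ℚ.≤ c u) → ∀ {S u v} → u ∈ S → v ∈ S → Adj v u → Saturated S v →
                     c u ℚ.* drop S u ℚ.≤ ε
    saturated-drop 0≤c {S} {u} {v} u∈S v∈S v~u sat = +-cancelˡ-≤ (expected G k c S) (begin
      expected G k c S ℚ.+ c u ℚ.* drop S u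
        ≡⟨ cong (ℚ._+ c u ℚ.* drop S u) (trans (sumOn-remove S v∈S F)
             (cong₂ ℚ._+_ (trans (cong (c v ℚ.*_) (prob-≥ sat)) (ℚ.*-identityʳ (c v))) (sumOn-remove (S - v) u∈S-v F))) ⟩
      (c v ℚ.+ (F u ℚ.+ sumOn (S - v - u) F)) ℚ.+ c u ℚ.* drop S u
        ≡⟨ solve 5 (λ x c p q s → (x :+ (c :* p :+ s)) :+ c :* (q :- p) := x :+ (c :* q :+ s)) refl
             (c v) (c u) (prob (k u) d) (prob (k u) (ℕ.pred d)) (sumOn (S - v - u) F) ⟩
      c v ℚ.+ (c u ℚ.* prob (k u) (ℕ.pred d) ℚ.+ sumOn (S - v - u) F)
        ≤⟨ ℚ.+-monoʳ-≤ (c v) (ℚ.+-mono-≤ (ℚ.≤-reflexive (cong (λ d → c u ℚ.* prob (k u) (ℕ.pred d)) (sym d≡)))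
             (sumOn-mono (S - v - u) (λ {w} _ → *-monoˡ-≤ (0≤c w) (prob-antitone w)))) ⟩
      c v ℚ.+ (F′ u ℚ.+ sumOn (S - v - u) F′)
        ≡⟨ cong₂ ℚ._+_ (when-true (degreeIn G S v ℕ.≤? k v) sat) (sumOn-remove (S - v) u∈S-v F′) ⟨
      expectedLast G k c S v
        ≤⟨ proj₁ (stable v∈S) ⟩
      expected G k c S ℚ.+ ε ∎)
      where
      open ℚ.≤-Reasoning
      d = degreeIn G S u
      F F′ : Fin n → ℚ
      F w  = c w ℚ.* prob (k w) (degreeIn G S w)
      F′ w = c w ℚ.* prob (k w) (degreeIn G (S - v) w)
      u∈S-v : u ∈ S - v
      u∈S-v = x∈p∧x≢y⇒x∈p-y u∈S (λ { refl → adj-irrefl u v~u })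
      d≡ : suc (degreeIn G (S - v) u) ≡ d
      d≡ = degreeIn-remove-adj G (adj-sym v~u) v∈S
      prob-antitone : ∀ w → prob (k w) (degreeIn G S w) ℚ.≤ prob (k w) (degreeIn G (S - v) w)
      prob-antitone w with adj? w v
      ... | yes w~v = subst (λ d → prob (k w) d ℚ.≤ prob (k w) (degreeIn G (S - v) w)) (degreeIn-remove-adj G w~v v∈S)
        (prob-suc-≤ (k w) (degreeIn G (S - v) w))
      ... | no w≁v = ℚ.≤-reflexive (cong (prob (k w)) (sym (degreeIn-remove-¬adj G w≁v)))

    -- The terms of `u` and `v` are the full weights of `S - u` and `S - v`. Both are within `ε` of
    -- E(S), so these weights differ by at most twice that.
    critical-weights : ∀ {S u v} → u ∈ S → v ∈ S → ¬ Saturated S u → ¬ Saturated S v →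
                       AllSaturated (S - u) → AllSaturated (S - v) → c v ℚ.≤ c u ℚ.+ ι 2 ℚ.* ε
    critical-weights {S} {u} {v} u∈S v∈S unsat-u unsat-v sat-u sat-v = +-cancelˡ-≤ (sumOn (S - v) c) (begin
      sumOn (S - v) c ℚ.+ c v           ≡⟨ ℚ.+-comm (sumOn (S - v) c) (c v) ⟩
      c v ℚ.+ sumOn (S - v) c           ≡⟨ sumOn-remove S v∈S c ⟨
      sumOn S c                         ≡⟨ sumOn-remove S u∈S c ⟩
      c u ℚ.+ sumOn (S - u) c           ≡⟨ cong (c u ℚ.+_) (last u unsat-u sat-u) ⟨
      c u ℚ.+ expectedLast G k c S u    ≤⟨ ℚ.+-monoʳ-≤ (c u) (proj₁ (stable u∈S)) ⟩
      c u ℚ.+ (expected G k c S ℚ.+ ε)  ≤⟨ ℚ.+-monoʳ-≤ (c u) (ℚ.+-monoˡ-≤ ε (proj₂ (stable v∈S))) ⟩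
      c u ℚ.+ ((expectedLast G k c S v ℚ.+ ε) ℚ.+ ε)
        ≡⟨ cong (λ x → c u ℚ.+ ((x ℚ.+ ε) ℚ.+ ε)) (last v unsat-v sat-v) ⟩
      c u ℚ.+ ((sumOn (S - v) c ℚ.+ ε) ℚ.+ ε)
        ≡⟨ solve 3 (λ a s e → a :+ ((s :+ e) :+ e) := s :+ (a :+ con (ι 2) :* e)) refl (c u) (sumOn (S - v) c) ε ⟩
      sumOn (S - v) c ℚ.+ (c u ℚ.+ ι 2 ℚ.* ε) ∎)
      where
      open ℚ.≤-Reasoning
      last : ∀ w → ¬ Saturated S w → AllSaturated (S - w) → expectedLast G k c S w ≡ sumOn (S - w) c
      last w unsat sat = trans (unsaturated⇒last c unsat) (allSaturated⇒expected c sat)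

    -- E(S - b) = E(S) = E(S - a) = E(S - a - b) up to errors, while the outer two differ by c(a).
    redundant-weight : ∀ {S a b} → a ∈ S → b ∈ S → a ≢ b → ¬ Saturated S a → ¬ Saturated S b →
                       ¬ Saturated (S - a) b → AllSaturated (S - b) → c a ℚ.≤ ι 3 ℚ.* ε
    redundant-weight {S} {a} {b} a∈S b∈S a≢b unsat-a unsat-b unsat-ab sat = +-cancelˡ-≤ (sumOn (S - b - a) c) (begin
      sumOn (S - b - a) c ℚ.+ c a     ≡⟨ ℚ.+-comm (sumOn (S - b - a) c) (c a) ⟩
      c a ℚ.+ sumOn (S - b - a) c     ≡⟨ sumOn-remove (S - b) (x∈p∧x≢y⇒x∈p-y a∈S a≢b) c ⟨
      sumOn (S - b) c                 ≡⟨ allSaturated⇒expected c sat ⟨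
      expected G k c (S - b)          ≡⟨ unsaturated⇒last c unsat-b ⟨
      expectedLast G k c S b          ≤⟨ proj₁ (stable b∈S) ⟩
      expected G k c S ℚ.+ ε          ≤⟨ ℚ.+-monoˡ-≤ ε (proj₂ (stable a∈S)) ⟩
      (expectedLast G k c S a ℚ.+ ε) ℚ.+ ε
        ≡⟨ cong (λ x → (x ℚ.+ ε) ℚ.+ ε) (unsaturated⇒last c unsat-a) ⟩
      (expected G k c (S - a) ℚ.+ ε) ℚ.+ ε
        ≤⟨ ℚ.+-monoˡ-≤ ε (ℚ.+-monoˡ-≤ ε (proj₂ (stable (x∈p∧x≢y⇒x∈p-y b∈S (a≢b ∘ sym))))) ⟩
      ((expectedLast G k c (S - a) b ℚ.+ ε) ℚ.+ ε) ℚ.+ ε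
        ≡⟨ cong (λ x → ((x ℚ.+ ε) ℚ.+ ε) ℚ.+ ε) (trans (unsaturated⇒last c unsat-ab)
             (trans (cong (expected G k c) (p─x─y≡p─y─x S a b)) (allSaturated⇒expected c (allSaturated-remove a sat)))) ⟩
      ((sumOn (S - b - a) c ℚ.+ ε) ℚ.+ ε) ℚ.+ ε
        ≡⟨ solve 2 (λ s e → ((s :+ e) :+ e) :+ e := s :+ con (ι 3) :* e) refl (sumOn (S - b - a) c) ε ⟩
      sumOn (S - b - a) c ℚ.+ ι 3 ℚ.* ε ∎)
      where open ℚ.≤-Reasoning

-- Connectedness, critical stars and cliques

module _ {n : ℕ} (G : Graph n) (connected : Connected G) where
  open Graph G

  connected-elim : (P : Fin n → Set) → (∀ {u v} → Adj u v → P u → P v) → ∀ {u} → P u → ∀ v → P v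
  connected-elim P step {u} pu v = go (connected u v) pu
    where
    go : ∀ {u v} → Star Adj u v → P u → P v
    go nil      pu = pu
    go (e ◅ es) pu = go es (step e pu)

  -- The walk is collapsed from its far end: once `w` is adjacent to `v`, the path through `u`, `w`,
  -- `v` closes.
  clique-from-paths : (∀ {a b d} → Adj b a → Adj b d → a ≢ d → Adj a d) → IsClique G
  clique-from-paths triangle u v = go (connected u v)
    where
    go : ∀ {u v} → Star Adj u v → u ≢ v → Adj u v
    go nil u≢u = contradiction refl u≢u
    go {u} {v} (_◅_ {j = w} u~w w⟶v) u≢v with w Fin.≟ v
    ... | yes refl = u~w
    ... | no w≢v   = triangle (adj-sym u~w) (go w⟶v w≢v) u≢v

-- The weights may vary with `ε`, while `G`, `k` and the lower bound `δ` are fixed beforehand.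
-- Conclusions about `G` and `k` alone are therefore exact, being refuted by a sufficiently small
-- `ε`.
module Extremal {n : ℕ} (G : Graph n) (connected : Connected G) (k : Fin n → ℕ)
  (δ : ℚ) (0<δ : 0ℚ ℚ.< δ)
  (approximation : ∀ ε → 0ℚ ℚ.< ε → ∃ λ c → (∀ u → δ ℚ.≤ c u) × Stable G k c ε)
  where
  open Graph G

  saturated-adj : ∀ {S u v} → u ∈ S → v ∈ S → Adj v u → Saturated G k S v → Saturated G k S u
  saturated-adj {S} {u} {v} u∈S v∈S v~u sat with degreeIn G S u ℕ.≤? k u
  ... | yes sat-u  = sat-u
  -- The drop does not depend on the weights, so `ε` can be chosen below `δ` times the drop before
  -- `c` is known.
  ... | no unsat-u with ℚ.<-dense (0<p*q 0<δ (0<drop G k unsat-u))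
  ... | ε , 0<ε , ε<δr with approximation ε 0<ε
  ... | c , δ≤c , stable = contradiction (ℚ.<-≤-trans ε<δr (ℚ.≤-trans
    (*-monoʳ-≤ (ℚ.<⇒≤ (0<drop G k unsat-u)) (δ≤c u))
    (saturated-drop G k stable (λ w → ℚ.≤-trans (ℚ.<⇒≤ 0<δ) (δ≤c w)) u∈S v∈S v~u sat)))
    (ℚ.<-irrefl refl)

  module _ (u₀ : Fin n) (k≢d : k u₀ ≢ degree G u₀) (k≤d : ∀ u → k u ℕ.≤ degree G u) where

    unsaturated : ∀ u → ¬ Saturated G k ⊤ u
    unsaturated = connected-elim G connected (λ u → ¬ Saturated G k ⊤ u)
      (λ u~v unsat-u sat-v → unsat-u (saturated-adj ∈⊤ ∈⊤ (adj-sym u~v) sat-v))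
      (λ sat → k≢d (ℕ.≤-antisym (k≤d u₀) (subst (ℕ._≤ k u₀) (degreeIn-⊤ G u₀) sat)))

    k<degree : ∀ u → k u ℕ.< degree G u
    k<degree u = subst (k u ℕ.<_) (degreeIn-⊤ G u) (ℕ.≰⇒> (unsaturated u))

    -- `A` holds the leaves that must occur. The number of leaves is the least that leaves the
    -- centre unsaturated; after any deletion only `suc (k v)` vertices remain, so no degree then
    -- exceeds `k v`.
    record Star-at (v : Fin n) (A : Subset n) : Set where
      field
        leaves  : Subset n
        A⊆      : A ⊆ leaves
        ⊆N      : leaves ⊆ neighbours G v
        ∣leaves∣ : ∣ leaves ∣ ≡ suc (k v)

      carrier : Subset n
      carrier = ⁅ v ⁆ ∪ leaves

      v∈ : v ∈ carrier
      v∈ = x∈⁅x⁆∪p v leaves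

      A⊆carrier : A ⊆ carrier
      A⊆carrier x∈A = x∈p∪q⁺ (inj₂ (A⊆ x∈A))

      ∣carrier∣ : ∣ carrier ∣ ≡ suc (suc (k v))
      ∣carrier∣ = trans (sym (x∈p⇒1+∣p-x∣≡∣p∣ carrier v∈)) (cong suc (trans
        (cong ∣_∣ ([⁅x⁆∪p]-x≡p leaves (λ v∈l → adj-irrefl v (∈-neighbours⁻ G (⊆N v∈l))))) ∣leaves∣))

      ∣carrier-x∣ : ∀ {x} → x ∈ carrier → ∣ carrier - x ∣ ≡ suc (k v)
      ∣carrier-x∣ x∈ = ℕ.suc-injective (trans (x∈p⇒1+∣p-x∣≡∣p∣ carrier x∈) ∣carrier∣)

      centre-unsaturated : ¬ Saturated G k carrier v
      centre-unsaturated sat = ℕ.<-irrefl refl (ℕ.<-≤-trans (ℕ.≤-reflexive (sym ∣leaves∣)) (ℕ.≤-trans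
        (p⊆q⇒∣p∣≤∣q∣ {q = neighbours G v ∩ carrier} (λ x∈ → x∈p∩q⁺ (⊆N x∈ , x∈p∪q⁺ (inj₂ x∈)))) sat))

      -- A saturated leaf would make the centre saturated by `saturated-adj`.
      all-unsaturated : ∀ {u} → u ∈ carrier → ¬ Saturated G k carrier u
      all-unsaturated {u} u∈ with x∈p∪q⁻ ⁅ v ⁆ leaves u∈
      ... | inj₁ u∈⁅v⁆ = subst (λ w → ¬ Saturated G k carrier w) (sym (x∈⁅y⁆⇒x≡y v u∈⁅v⁆)) centre-unsaturated
      ... | inj₂ u∈l   = λ sat → centre-unsaturated (saturated-adj v∈ u∈ (adj-sym (∈-neighbours⁻ G (⊆N u∈l))) sat)

    star-at : ∀ v A → A ⊆ neighbours G v → ∣ A ∣ ℕ.≤ suc (k v) → Star-at v A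
    star-at v A A⊆N ∣A∣≤ with p⊆q∧∣p∣≤j≤∣q∣⇒between A⊆N ∣A∣≤ (k<degree v)
    ... | T , A⊆T , T⊆N , ∣T∣≡ = record { leaves = T ; A⊆ = A⊆T ; ⊆N = T⊆N ; ∣leaves∣ = ∣T∣≡ }

    edge-star : ∀ {u v} → Adj v u → Star-at v ⁅ u ⁆
    edge-star {u} {v} v~u = star-at v ⁅ u ⁆
      (λ x∈ → subst (_∈ neighbours G v) (sym (x∈⁅y⁆⇒x≡y u x∈)) (∈-neighbours⁺ G v~u))
      (ℕ.≤-trans (ℕ.≤-reflexive (∣⁅x⁆∣≡1 u)) (s≤s z≤n))

    -- The leaf `u` is unsaturated, yet in a star on `k v` + 2 vertices its degree is at most `k v`
    -- + 1.
    k-adj-≤ : ∀ {u v} → Adj v u → k u ℕ.≤ k v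
    k-adj-≤ {u} {v} v~u = ℕ.≤-pred (ℕ.<-≤-trans (ℕ.≰⇒> (all-unsaturated u∈))
      (ℕ.≤-pred (ℕ.<-≤-trans (degreeIn<∣S∣ G u∈) (ℕ.≤-reflexive ∣carrier∣))))
      where
      open Star-at (edge-star v~u)
      u∈ = A⊆carrier (x∈⁅x⁆ u)

    k-constant : ∀ u v → k u ≡ k v
    k-constant u = connected-elim G connected (λ v → k u ≡ k v)
      (λ v~w eq → trans eq (ℕ.≤-antisym (k-adj-≤ (adj-sym v~w)) (k-adj-≤ v~w))) refl

    -- The star on the edge is critical, because `k` is constant. Here `c` and `ε` are arbitrary:
    -- the conclusion is about weights and is needed at all late approximations.
    c-adj : ∀ {u v} → Adj v u → ∀ {c ε} → Stable G k c ε → c v ℚ.≤ c u ℚ.+ ι 2 ℚ.* ε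
    c-adj {u} {v} v~u stable = critical-weights G k stable u∈ v∈ (all-unsaturated u∈) (all-unsaturated v∈) (sat u∈) (sat v∈)
      where
      open Star-at (edge-star v~u)
      u∈ = A⊆carrier (x∈⁅x⁆ u)
      sat : ∀ {x} → x ∈ carrier → AllSaturated G k (carrier - x)
      sat x∈ {w} w∈ = ℕ.≤-pred (ℕ.<-≤-trans (degreeIn<∣S∣ G w∈)
        (ℕ.≤-reflexive (trans (∣carrier-x∣ x∈) (cong suc (k-constant v w)))))

    module _ {a b d} (b~a : Adj b a) (b~d : Adj b d) (a≢d : a ≢ d) where

      -- There are at least two leaves, so `a` and `d` fit into one star. Without the edge between
      -- them the degree of `a` would not change on deleting `d`, hence be at most `k b`, and `a`
      -- would be saturated.
      adj-of-positive : 1 ℕ.≤ k b → Adj a d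
      adj-of-positive 1≤k with adj? a d
      ... | yes a~d = a~d
      ... | no a≁d  = contradiction small (all-unsaturated a∈)
        where
        A = ⁅ a ⁆ ∪ ⁅ d ⁆
        A⊆N : A ⊆ neighbours G b
        A⊆N x∈ with x∈p∪q⁻ ⁅ a ⁆ ⁅ d ⁆ x∈
        ... | inj₁ x∈⁅a⁆ = subst (_∈ neighbours G b) (sym (x∈⁅y⁆⇒x≡y a x∈⁅a⁆)) (∈-neighbours⁺ G b~a)
        ... | inj₂ x∈⁅d⁆ = subst (_∈ neighbours G b) (sym (x∈⁅y⁆⇒x≡y d x∈⁅d⁆)) (∈-neighbours⁺ G b~d)
        open Star-at (star-at b A A⊆N (ℕ.≤-trans (∣⁅x⁆∪p∣≤1+∣p∣ a ⁅ d ⁆)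
          (s≤s (ℕ.≤-trans (ℕ.≤-reflexive (∣⁅x⁆∣≡1 d)) 1≤k))))
        a∈ = A⊆carrier (x∈⁅x⁆∪p a ⁅ d ⁆)
        d∈ = A⊆carrier (x∈p∪q⁺ (inj₂ (x∈⁅x⁆ d)))
        small : Saturated G k carrier a
        small = ℕ.≤-pred (subst₂ ℕ._≤_ (cong suc (degreeIn-remove-¬adj G a≁d))
          (trans (∣carrier-x∣ d∈) (cong suc (k-constant b a))) (degreeIn<∣S∣ G (x∈p∧x≢y⇒x∈p-y a∈ a≢d)))

      -- A star has a single leaf here, so the induced path on `a`, `b`, `d` is used instead. All
      -- its vertices are unsaturated, `b` stays so without `a`, and the two ends are independent
      -- without `b`.
      adj-of-zero : k b ≡ 0 → Adj a d
      adj-of-zero k≡0 with adj? a d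
      ... | yes a~d = a~d
      -- `redundant-weight` bounds `c a` by three errors, while `c a` is at least `δ`.
      ... | no a≁d with shrink (ι 3) δ (0≤ι 3) 0<δ
      ... | ε , 0<ε , 3ε<δ with approximation ε 0<ε
      ... | c , δ≤c , stable = contradiction (ℚ.<-≤-trans 3ε<δ (ℚ.≤-trans (δ≤c a)
        (redundant-weight G k stable a∈ b∈ a≢b (unsat a b∈ (adj-sym b~a)) (unsat b d∈ b~d)
          (unsat b (x∈p∧x≢y⇒x∈p-y d∈ (a≢d ∘ sym)) b~d) sat)))
        (ℚ.<-irrefl refl)
        where
        S = ⁅ a ⁆ ∪ (⁅ b ⁆ ∪ ⁅ d ⁆)
        a≢b : a ≢ b
        a≢b refl = adj-irrefl a b~a
        a∈ : a ∈ S
        a∈ = x∈⁅x⁆∪p a (⁅ b ⁆ ∪ ⁅ d ⁆)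
        b∈ : b ∈ S
        b∈ = x∈p∪q⁺ (inj₂ (x∈⁅x⁆∪p b ⁅ d ⁆))
        d∈ : d ∈ S
        d∈ = x∈p∪q⁺ {p = ⁅ a ⁆} (inj₂ (x∈p∪q⁺ {p = ⁅ b ⁆} (inj₂ (x∈⁅x⁆ d))))
        unsat : ∀ {T} u {v} → v ∈ T → Adj u v → ¬ Saturated G k T u
        unsat u v∈T u~v sat = contradiction (ℕ.<-≤-trans (x∈p⇒0<∣p∣ (x∈p∩q⁺ (∈-neighbours⁺ G u~v , v∈T)))
          (ℕ.≤-trans sat (ℕ.≤-reflexive (trans (k-constant u b) k≡0)))) λ ()
        ends : ∀ {x} → x ∈ S - b → x ≡ a ⊎ x ≡ d
        ends x∈ with x∈p∪q⁻ ⁅ a ⁆ (⁅ b ⁆ ∪ ⁅ d ⁆) (x∈p-y⇒x∈p S b x∈)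
        ... | inj₁ x∈⁅a⁆ = inj₁ (x∈⁅y⁆⇒x≡y a x∈⁅a⁆)
        ... | inj₂ x∈bd with x∈p∪q⁻ ⁅ b ⁆ ⁅ d ⁆ x∈bd
        ...   | inj₁ x∈⁅b⁆ = contradiction (x∈⁅y⁆⇒x≡y b x∈⁅b⁆) (x∈p-y⇒x≢y S x∈)
        ...   | inj₂ x∈⁅d⁆ = inj₂ (x∈⁅y⁆⇒x≡y d x∈⁅d⁆)
        independent : ∀ {x y} → x ∈ S - b → y ∈ S - b → ¬ Adj x y
        independent x∈ y∈ x~y with ends x∈ | ends y∈
        ... | inj₁ refl | inj₁ refl = adj-irrefl a x~y
        ... | inj₁ refl | inj₂ refl = a≁d x~y
        ... | inj₂ refl | inj₁ refl = a≁d (adj-sym x~y)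
        ... | inj₂ refl | inj₂ refl = adj-irrefl d x~y
        sat : AllSaturated G k (S - b)
        sat {u} u∈ = ℕ.≤-trans (ℕ.≤-reflexive (trans (cong ∣_∣ (Empty-unique λ (x , x∈) →
          let x∈N , x∈S-b = x∈p∩q⁻ (neighbours G u) (S - b) x∈
          in independent u∈ x∈S-b (∈-neighbours⁻ G x∈N))) (∣⊥∣≡0 n))) z≤n

      adj-transitive : Adj a d
      adj-transitive with ℕ.<-≤-connex 0 (k b)
      ... | inj₁ 1≤k = adj-of-positive 1≤k
      ... | inj₂ k≤0 = adj-of-zero (ℕ.n≤0⇒n≡0 k≤0)

    clique : IsClique G
    clique = clique-from-paths G connected adj-transitive

-- Passing to real weights

eventually-map : ∀ {P Q : Pred ℕ 0ℓ} → (∀ {m} → P m → Q m) → Eventually P → Eventually Q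
eventually-map P⇒Q (N , p) = N , λ m N≤m → P⇒Q (p m N≤m)

eventually-× : ∀ {P Q : Pred ℕ 0ℓ} → Eventually P → Eventually Q → Eventually (λ m → P m × Q m)
eventually-× (M , p) (N , q) = M ℕ.⊔ N , λ m ≤m →
  p m (ℕ.m⊔n≤o⇒m≤o M N ≤m) , q m (ℕ.m⊔n≤o⇒n≤o M N ≤m)

eventually-∀ : ∀ {n} {P : Fin n → Pred ℕ 0ℓ} → (∀ u → Eventually (P u)) → Eventually (λ m → ∀ u → P u m)
eventually-∀ {zero}  p = 0 , λ _ _ ()
eventually-∀ {suc n} p = eventually-map (λ { (p₀ , ps) zero → p₀ ; (p₀ , ps) (suc u) → ps u })
  (eventually-× (p zero) (eventually-∀ (p ∘ suc)))

≈ℝ-refl : ∀ {x} → x ≈ℝ x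
≈ℝ-refl {x} ε 0<ε = 0 , λ m _ → subst (ℚ._< ε) (cong ℚ.∣_∣ (sym (ℚ.+-inverseʳ (seq x m)))) 0<ε

≈ℝ-trans : ∀ {x y z} → x ≈ℝ y → y ≈ℝ z → x ≈ℝ z
≈ℝ-trans {x} {y} {z} x≈y y≈z ε 0<ε with shrink (ι 2) ε (0≤ι 2) 0<ε
... | δ , 0<δ , 2δ<ε = eventually-map (λ {m} → close m) (eventually-× (x≈y δ 0<δ) (y≈z δ 0<δ))
  where
  close : ∀ m → ℚ.∣ seq x m ℚ.- seq y m ∣ ℚ.< δ × ℚ.∣ seq y m ℚ.- seq z m ∣ ℚ.< δ → ℚ.∣ seq x m ℚ.- seq z m ∣ ℚ.< ε
  close m (xy , yz) = begin-strict
    ℚ.∣ seq x m ℚ.- seq z m ∣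
      ≡⟨ cong ℚ.∣_∣ (solve 3 (λ x y z → x :- z := (x :- y) :+ (y :- z)) refl (seq x m) (seq y m) (seq z m)) ⟩
    ℚ.∣ (seq x m ℚ.- seq y m) ℚ.+ (seq y m ℚ.- seq z m) ∣  ≤⟨ ℚ.∣p+q∣≤∣p∣+∣q∣ (seq x m ℚ.- seq y m) (seq y m ℚ.- seq z m) ⟩
    ℚ.∣ seq x m ℚ.- seq y m ∣ ℚ.+ ℚ.∣ seq y m ℚ.- seq z m ∣  <⟨ ℚ.+-mono-< xy yz ⟩
    δ ℚ.+ δ      ≡⟨ solve 1 (λ d → d :+ d := con (ι 2) :* d) refl δ ⟩
    ι 2 ℚ.* δ    <⟨ 2δ<ε ⟩
    ε            ∎
    where open ℚ.≤-Reasoning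

seq-∑ : ∀ {n} (x : Fin n → ℝ) m → seq (∑ x) m ≡ sum (λ u → seq (x u) m)
seq-∑ {zero}  x m = refl
seq-∑ {suc n} x m = cong (seq (x zero) m ℚ.+_) (seq-∑ (x ∘ suc) m)

seq-weight : ∀ {n} (c : Fin n → ℝ) I m → seq (weight c I) m ≡ sumOn I (λ u → seq (c u) m)
seq-weight c I m = trans (seq-∑ (λ u → if does (u ∈? I) then c u else 0ℝ) m)
  (sum-cong-≗ λ u → seq-if u)
  where
  seq-if : ∀ u → seq (if does (u ∈? I) then c u else 0ℝ) m ≡ when (u ∈? I) (seq (c u) m)
  seq-if u with does (u ∈? I)
  ... | true  = refl
  ... | false = refl

module _ (m : ℕ) where

  seq-foldr-⊔-≥ : ∀ {x xs} → x ∈ₗ xs → seq x m ℚ.≤ seq (foldr _⊔ℝ_ 0ℝ xs) m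
  seq-foldr-⊔-≥ {xs = y List.∷ xs} (Any.here refl)  = ℚ.p≤p⊔q (seq y m) (seq (foldr _⊔ℝ_ 0ℝ xs) m)
  seq-foldr-⊔-≥ {xs = y List.∷ xs} (Any.there x∈xs) =
    ℚ.≤-trans (seq-foldr-⊔-≥ x∈xs) (ℚ.p≤q⊔p (seq y m) (seq (foldr _⊔ℝ_ 0ℝ xs) m))

  seq-foldr-⊔-≤ : ∀ {b xs} → 0ℚ ℚ.≤ b → All (λ x → seq x m ℚ.≤ b) xs → seq (foldr _⊔ℝ_ 0ℝ xs) m ℚ.≤ b
  seq-foldr-⊔-≤ 0≤b All.[]       = 0≤b
  seq-foldr-⊔-≤ 0≤b (p All.∷ ps) = ℚ.⊔-lub p (seq-foldr-⊔-≤ 0≤b ps)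

∈-allSubsets : ∀ {n} (I : Subset n) → I ∈ₗ allSubsets n
∈-allSubsets []            = Any.here refl
∈-allSubsets (outside ∷ I) = ∈-++⁺ˡ (∈-map⁺ (outside ∷_) (∈-allSubsets I))
∈-allSubsets (inside ∷ I)  = ∈-++⁺ʳ (List.map (outside ∷_) (allSubsets _)) (∈-map⁺ (inside ∷_) (∈-allSubsets I))

module _ {n : ℕ} (G : Graph n) (c : Fin n → ℝ) (κ : Fin n → ℤ) (m : ℕ) where

  seq-α-≥ : ∀ {I} → Degenerate G κ I → sumOn I (λ u → seq (c u) m) ℚ.≤ seq (α G c κ) m
  seq-α-≥ {I} deg-I = subst (ℚ._≤ seq (α G c κ) m) (seq-weight c I m)
    (seq-foldr-⊔-≥ m (∈-map⁺ (weight c) (∈-filter⁺ (degenerate? G κ) (∈-allSubsets I) deg-I)))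

  seq-α-≤ : ∀ {b} → 0ℚ ℚ.≤ b → (∀ {I} → Degenerate G κ I → sumOn I (λ u → seq (c u) m) ℚ.≤ b) →
            seq (α G c κ) m ℚ.≤ b
  seq-α-≤ {b} 0≤b upper = seq-foldr-⊔-≤ m 0≤b (All.map⁺ (All.map
    (λ {I} deg-I → subst (ℚ._≤ b) (sym (seq-weight c I m)) (upper deg-I))
    (all-filter (degenerate? G κ) (allSubsets n))))

-- Provides the `δ` that `Extremal` fixes in advance, as a minimum over the vertices; the value 1
-- serves when there are none.
uniformly-positive : ∀ {n} (c : Fin n → ℝ) → (∀ u → 0ℝ <ℝ c u) →
  ∃ λ δ → 0ℚ ℚ.< δ × Eventually (λ m → ∀ u → δ ℚ.≤ seq (c u) m)
uniformly-positive {zero}  c 0<c = 1ℚ , 0<1ℚ , 0 , λ _ _ ()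
uniformly-positive {suc n} c 0<c with 0<c zero | uniformly-positive (c ∘ suc) (0<c ∘ suc)
... | δ₀ , 0<δ₀ , N₀ , h₀ | δ , 0<δ , N , h = δ₀ ℚ.⊓ δ , 0<min , N₀ ℕ.⊔ N , λ where
    m ≤m zero    → ℚ.≤-trans (ℚ.p⊓q≤p δ₀ δ) (subst (ℚ._≤ seq (c zero) m) (ℚ.+-identityˡ δ₀) (h₀ m (ℕ.m⊔n≤o⇒m≤o N₀ N ≤m)))
    m ≤m (suc u) → ℚ.≤-trans (ℚ.p⊓q≤q δ₀ δ) (h m (ℕ.m⊔n≤o⇒n≤o N₀ N ≤m) u)
  where
  0<min : 0ℚ ℚ.< δ₀ ℚ.⊓ δ
  0<min with ℚ.≤-total δ₀ δ
  ... | inj₁ δ₀≤δ = subst (0ℚ ℚ.<_) (sym (ℚ.p≤q⇒p⊓q≡p δ₀≤δ)) 0<δ₀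
  ... | inj₂ δ≤δ₀ = subst (0ℚ ℚ.<_) (sym (ℚ.p≥q⇒p⊓q≡q δ≤δ₀)) 0<δ

-- Sizes and degrees in cliques

-- All other vertices of `I` precede the last one and are adjacent to it, so the bound at the last
-- vertex limits their number to `K`.
clique-degenerate-size : ∀ {n} (G : Graph n) (κ : Fin n → ℤ) → IsClique G → ∀ {K} → (∀ u → κ u ≡ + K) →
  ∀ {I} → Degenerate G κ I → ∣ I ∣ ℕ.≤ suc K
clique-degenerate-size {n} G κ clique {K} κ≡K {I} (zero , us , o) = ℕ.≤-trans
  (ℕ.≤-reflexive (trans (cong ∣_∣ (Empty-unique empty)) (∣⊥∣≡0 n))) z≤n
  where
  open IsDegenerateOrdering o
  empty : ¬ Nonempty I
  empty (x , x∈I) with Equivalence.to (enumerates x) x∈I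
  ... | () , _
clique-degenerate-size G κ clique {K} κ≡K {I} (suc j , us , o) = ℕ.≤-trans (∣p∣≤1+∣p-x∣ I w)
  (s≤s (ℕ.≤-trans (p⊆q⇒∣p∣≤∣q∣ {q = neighbours G w ∩ predecessors us (fromℕ j)} others)
    (ℤ.drop‿+≤+ (subst (+ degreeIn G (predecessors us (fromℕ j)) w ℤ.≤_) (κ≡K w) (bound (fromℕ j))))))
  where
  open IsDegenerateOrdering o
  w = lookup us (fromℕ j)
  others : I - w ⊆ neighbours G w ∩ predecessors us (fromℕ j)
  others {x} x∈ with Equivalence.to (enumerates x) (x∈p-y⇒x∈p I w x∈)
  ... | i , refl with view i
  ...   | ‵fromℕ     = contradiction refl (x∈p-y⇒x≢y I x∈)
  ...   | ‵inject₁ i = x∈p∩q⁺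
    ( ∈-neighbours⁺ G (clique _ _ (x∈p-y⇒x≢y I x∈ ∘ sym))
    , ∈-comprehension⁺ (precedes? us (fromℕ j))
        (inject₁ i , subst₂ ℕ._<_ (sym (Fin.toℕ-inject₁ i)) (sym (Fin.toℕ-fromℕ j)) (Fin.toℕ<n i) , refl))

clique-degreeIn-⊤ : ∀ {n} (G : Graph n) → IsClique G → ∀ u → suc (degreeIn G ⊤ u) ≡ n
clique-degreeIn-⊤ {n} G clique u = trans (ℕ.≤-antisym (degreeIn<∣S∣ G ∈⊤)
  (ℕ.≤-trans (∣p∣≤1+∣p-x∣ ⊤ u) (s≤s (p⊆q⇒∣p∣≤∣q∣ {q = neighbours G u ∩ ⊤} λ x∈ →
    x∈p∩q⁺ (∈-neighbours⁺ G (clique _ _ (x∈p-y⇒x≢y ⊤ x∈ ∘ sym)) , ∈⊤))))) (∣⊤∣≡n n)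

-- Both implications for real weights

module _ {n : ℕ} (G : Graph n) (c : Fin n → ℝ) (0<c : ∀ u → 0ℝ <ℝ c u)
  (κ : Fin n → ℤ) (k : Fin n → ℕ) (κ≡+k : ∀ u → κ u ≡ + k u) (k≤d : ∀ u → k u ℕ.≤ degree G u) where
  open Graph G

  target : ℝ
  target = ∑ (λ u → c u *ℝ fromℚ ((κ u ℤ.+ 1ℤ) / suc (degree G u)))

  at : ℕ → Fin n → ℚ
  at m u = seq (c u) m

  -- Because `k` never exceeds the degree, the truncation in `prob` is inactive and its value is the
  -- fraction in the sum.
  seq-target : ∀ m → seq target m ≡ expected G k (at m) ⊤
  seq-target m = trans (seq-∑ (λ u → c u *ℝ fromℚ ((κ u ℤ.+ 1ℤ) / suc (degree G u))) m)
    (trans (sum-cong-≗ λ u → cong (at m u ℚ.*_) (fraction u)) (sym (sumOn-⊤ (λ u → at m u ℚ.* prob (k u) (degreeIn G ⊤ u)))))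
    where
    fraction : ∀ u → (κ u ℤ.+ 1ℤ) / suc (degree G u) ≡ prob (k u) (degreeIn G ⊤ u)
    fraction u = trans (cong (_/ suc (degree G u)) (trans (cong (ℤ._+ 1ℤ) (κ≡+k u)) (cong +_ (ℕ.+-comm (k u) 1))))
      (trans (sym (prob-≤ (k≤d u))) (cong (prob (k u)) (sym (degreeIn-⊤ G u))))

  -- The known lower bound, valid without error at every index of the approximating sequences.
  target≤α : ∀ m → seq target m ℚ.≤ seq (α G c κ) m
  target≤α m =
    let I , _ , deg-I , E≤I = degenerate-above-expected G κ k κ≡+k (at m) ⊤
    in ℚ.≤-trans (ℚ.≤-reflexive (seq-target m)) (ℚ.≤-trans E≤I (seq-α-≥ G c κ m deg-I))

  α≈target : (∀ ε → 0ℚ ℚ.< ε → Eventually λ m → Tight G κ k κ≡+k (at m) ⊤ ε) → α G c κ ≈ℝ target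
  α≈target tight ε 0<ε =
    -- Tightness is a weak inequality, so it is invoked at some `η` strictly below `ε`.
    let η , 0<η , η<ε = ℚ.<-dense 0<ε in eventually-map (λ {m} → close m η<ε) (tight η 0<η)
    where
    close : ∀ m {η} → η ℚ.< ε → Tight G κ k κ≡+k (at m) ⊤ η → ℚ.∣ seq (α G c κ) m ℚ.- seq target m ∣ ℚ.< ε
    close m {η} η<ε tight-m = p<q+ε⇒∣p-q∣<ε
      (ℚ.≤-<-trans (seq-α-≤ G c κ m nonneg upper) (ℚ.+-monoʳ-< (seq target m) η<ε))
      (ℚ.≤-<-trans (target≤α m) (subst (ℚ._< seq (α G c κ) m ℚ.+ ε) (ℚ.+-identityʳ (seq (α G c κ) m))
        (ℚ.+-monoʳ-< (seq (α G c κ) m) 0<ε)))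
      where
      upper : ∀ {I} → Degenerate G κ I → sumOn I (at m) ℚ.≤ seq target m ℚ.+ η
      upper {I} deg-I = subst (λ t → sumOn I (at m) ℚ.≤ t ℚ.+ η) (sym (seq-target m)) (tight-m ⊆⊤ deg-I)
      -- The maximum in `α` starts from `0ℝ`, so the bound must also dominate 0; it does, because
      -- the empty set is degenerate.
      nonneg : 0ℚ ℚ.≤ seq target m ℚ.+ η
      nonneg = subst (ℚ._≤ seq target m ℚ.+ η)
        (trans (sumOn-cong {n} ⊥ {at m} {λ _ → 0ℚ} (λ u∈⊥ → contradiction u∈⊥ ∉⊥)) (trans (sumOn-const (⊥ {n}) 0ℚ) (ℚ.*-zeroʳ (ι ∣ ⊥ {n} ∣))))
        (upper (degenerate-⊥ G κ))

  eventually-tight : α G c κ ≈ℝ target → ∀ ε → 0ℚ ℚ.< ε → Eventually λ m → Tight G κ k κ≡+k (at m) ⊤ ε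
  eventually-tight α≈t ε 0<ε = eventually-map (λ {m} → tight m) (α≈t ε 0<ε)
    where
    tight : ∀ m → ℚ.∣ seq (α G c κ) m ℚ.- seq target m ∣ ℚ.< ε → Tight G κ k κ≡+k (at m) ⊤ ε
    tight m close {I} _ deg-I = subst (λ t → sumOn I (at m) ℚ.≤ t ℚ.+ ε) (seq-target m)
      (ℚ.≤-trans (seq-α-≥ G c κ m deg-I) (ℚ.<⇒≤ (∣p-q∣<ε⇒p<q+ε close)))

  eventually-stable : α G c κ ≈ℝ target → ∀ ε → 0ℚ ℚ.< ε → Eventually λ m → Stable G k (at m) ε
  eventually-stable α≈t ε 0<ε =
    let η , 0<η , small = scale-small n (suc n) ε 0<ε
    in eventually-map (λ {m} → stable m 0<η small) (eventually-tight α≈t η 0<η)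
    where
    stable : ∀ m {η} → 0ℚ ℚ.< η → scale n (suc n) η ℚ.≤ ε → Tight G κ k κ≡+k (at m) ⊤ η → Stable G k (at m) ε
    stable m 0<η small tight {S} {v} v∈S =
      let upper , lower = tight⇒stable G κ k κ≡+k (at m) (ℚ.<⇒≤ 0<η) tight v∈S
      in ℚ.≤-trans upper (ℚ.+-monoʳ-≤ (expected G k (at m) S) small)
       , ℚ.≤-trans lower (ℚ.+-monoʳ-≤ (expectedLast G k (at m) S v) small)

  stable⇒structure : Connected G → (∀ ε → 0ℚ ℚ.< ε → Eventually λ m → Stable G k (at m) ε) →
    (∀ u → k u ≡ degree G u) ⊎ (IsClique G × (∀ u v → c u ≈ℝ c v) × (∀ u v → k u ≡ k v))
  stable⇒structure connected stable with Fin.all? (λ u → k u ℕ.≟ degree G u) | uniformly-positive c 0<c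
  ... | yes k≡d | _ = inj₁ k≡d
  ... | no ¬k≡d | δ , 0<δ , positive with Fin.¬∀⟶∃¬ n _ (λ u → k u ℕ.≟ degree G u) ¬k≡d
  ... | u₀ , k≢d = inj₂
      ( clique u₀ k≢d k≤d
      , (λ u → connected-elim G connected (λ v → c u ≈ℝ c v)
          (λ {v} {w} v~w u≈v → ≈ℝ-trans {c u} {c v} {c w} u≈v (adj⇒≈ v~w)) (≈ℝ-refl {c u}))
      , k-constant u₀ k≢d k≤d )
    where
    approximation : ∀ ε → 0ℚ ℚ.< ε → ∃ λ c → (∀ u → δ ℚ.≤ c u) × Stable G k c ε
    -- A single index suffices, the first one past both thresholds.
    approximation ε 0<ε = let N , h = eventually-× positive (stable ε 0<ε) in at N , h N ℕ.≤-refl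
    open Extremal G connected k δ 0<δ approximation
    adj⇒≈ : ∀ {u v} → Adj u v → c u ≈ℝ c v
    adj⇒≈ {u} {v} u~v ε 0<ε with shrink (ι 2) ε (0≤ι 2) 0<ε
    ... | η , 0<η , 2η<ε = eventually-map (λ {m} → close m) (stable η 0<η)
      where
      close : ∀ m → Stable G k (at m) η → ℚ.∣ at m u ℚ.- at m v ∣ ℚ.< ε
      close m stable-m = p<q+ε⇒∣p-q∣<ε
        (ℚ.≤-<-trans (c-adj u₀ k≢d k≤d u~v stable-m) (ℚ.+-monoʳ-< (at m v) 2η<ε))
        (ℚ.≤-<-trans (c-adj u₀ k≢d k≤d (adj-sym u~v) stable-m) (ℚ.+-monoʳ-< (at m u) 2η<ε))

  -- Every vertex is saturated, so E(V) is the total weight, which bounds the weight of every subset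
  -- once the approximations are nonnegative.
  full⇒tight : (∀ u → k u ≡ degree G u) → ∀ ε → 0ℚ ℚ.< ε → Eventually λ m → Tight G κ k κ≡+k (at m) ⊤ ε
  full⇒tight k≡d ε 0<ε with uniformly-positive c 0<c
  ... | δ , 0<δ , positive = eventually-map (λ {m} δ≤c {I} _ _ → begin
      sumOn I (at m)              ≤⟨ sumOn-≤-sum I (λ u → ℚ.≤-trans (ℚ.<⇒≤ 0<δ) (δ≤c u)) ⟩
      sum (at m)                  ≡⟨ sumOn-⊤ (at m) ⟨
      sumOn ⊤ (at m)              ≡⟨ allSaturated⇒expected G k (at m) {⊤} (λ {u} _ → ℕ.≤-reflexive (trans (degreeIn-⊤ G u) (sym (k≡d u)))) ⟨
      expected G k (at m) ⊤       ≤⟨ p≤p+q (ℚ.<⇒≤ 0<ε) ⟩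
      expected G k (at m) ⊤ ℚ.+ ε ∎) positive
    where open ℚ.≤-Reasoning

  -- Up to `η` all weights equal that of the reference vertex `u₀`. A degenerate set has at most
  -- `suc K` vertices, and the `n` equal probabilities add up to `suc K`, so the two sides differ by
  -- at most 2(K + 1)η.
  clique⇒tight : Fin n → IsClique G → (∀ u v → c u ≈ℝ c v) → (∀ u v → k u ≡ k v) →
    ∀ ε → 0ℚ ℚ.< ε → Eventually λ m → Tight G κ k κ≡+k (at m) ⊤ ε
  clique⇒tight u₀ clique c≈ k≡ ε 0<ε with uniformly-positive c 0<c | shrink (ι 2 ℚ.* s) ε (0≤p*q (0≤ι 2) (0≤ι (suc (k u₀)))) 0<ε
    where s = ι (suc (k u₀))
  ... | δ , 0<δ , positive | η , 0<η , small =
    eventually-map (λ {m} (δ≤c , close) {I} _ deg-I → bound m (δ≤c u₀) close deg-I)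
      (eventually-× positive (eventually-∀ λ u → eventually-× (c≈ u u₀ η 0<η) (c≈ u₀ u η 0<η)))
    where
    K = k u₀
    s = ι (suc K)
    p = prob K (degreeIn G ⊤ u₀)

    bound : ∀ m → δ ℚ.≤ at m u₀ →
      (∀ u → ℚ.∣ at m u ℚ.- at m u₀ ∣ ℚ.< η × ℚ.∣ at m u₀ ℚ.- at m u ∣ ℚ.< η) →
      ∀ {I} → Degenerate G κ I → sumOn I (at m) ℚ.≤ expected G k (at m) ⊤ ℚ.+ ε
    bound m δ≤c₀ close {I} deg-I = begin
      sumOn I (at m)
        ≤⟨ sumOn-mono I (λ {u} _ → ℚ.<⇒≤ (∣p-q∣<ε⇒p<q+ε (proj₁ (close u)))) ⟩
      sumOn I (λ _ → c₀ ℚ.+ η)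
        ≡⟨ sumOn-const I (c₀ ℚ.+ η) ⟩
      ι ∣ I ∣ ℚ.* (c₀ ℚ.+ η)
        ≤⟨ *-monoʳ-≤ (ℚ.+-mono-≤ (ℚ.≤-trans (ℚ.<⇒≤ 0<δ) δ≤c₀) (ℚ.<⇒≤ 0<η))
             (ι-mono-≤ (clique-degenerate-size G κ clique (λ u → trans (κ≡+k u) (cong +_ (k≡ u u₀))) deg-I)) ⟩
      s ℚ.* (c₀ ℚ.+ η)
        ≡⟨ solve 3 (λ s c e → s :* (c :+ e) := s :* (c :- e) :+ con (ι 2) :* s :* e) refl s c₀ η ⟩
      s ℚ.* (c₀ ℚ.- η) ℚ.+ ι 2 ℚ.* s ℚ.* η
        ≤⟨ ℚ.+-mono-≤ lower (ℚ.<⇒≤ small) ⟩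
      expected G k (at m) ⊤ ℚ.+ ε ∎
      where
      open ℚ.≤-Reasoning
      c₀ = at m u₀
      ιn*p≡s : ι n ℚ.* p ≡ s
      ιn*p≡s = trans (cong₂ (λ j q → ι j ℚ.* q) (sym (clique-degreeIn-⊤ G clique u₀))
        (prob-≤ (subst (K ℕ.≤_) (sym (degreeIn-⊤ G u₀)) (k≤d u₀)))) (ι-suc-*-/ (suc K) (degreeIn G ⊤ u₀))
      p≡ : ∀ u → p ≡ prob (k u) (degreeIn G ⊤ u)
      p≡ u = cong₂ prob (k≡ u₀ u) (ℕ.suc-injective (trans (clique-degreeIn-⊤ G clique u₀) (sym (clique-degreeIn-⊤ G clique u))))
      lower : s ℚ.* (c₀ ℚ.- η) ℚ.≤ expected G k (at m) ⊤
      lower = begin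
        s ℚ.* (c₀ ℚ.- η)
          ≡⟨ cong (ℚ._* (c₀ ℚ.- η)) ιn*p≡s ⟨
        ι n ℚ.* p ℚ.* (c₀ ℚ.- η)
          ≡⟨ solve 3 (λ i p x → i :* p :* x := i :* (x :* p)) refl (ι n) p (c₀ ℚ.- η) ⟩
        ι n ℚ.* ((c₀ ℚ.- η) ℚ.* p)
          ≡⟨ cong (λ j → ι j ℚ.* ((c₀ ℚ.- η) ℚ.* p)) (∣⊤∣≡n n) ⟨
        ι ∣ ⊤ {n} ∣ ℚ.* ((c₀ ℚ.- η) ℚ.* p)
          ≡⟨ sumOn-const (⊤ {n}) ((c₀ ℚ.- η) ℚ.* p) ⟨
        sumOn (⊤ {n}) (λ _ → (c₀ ℚ.- η) ℚ.* p)
          ≤⟨ sumOn-mono (⊤ {n}) (λ {u} _ → ℚ.≤-trans (*-monoʳ-≤ (0≤prob K (degreeIn G ⊤ u₀)) (c₀-η≤ u))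
               (ℚ.≤-reflexive (cong (at m u ℚ.*_) (p≡ u)))) ⟩
        expected G k (at m) ⊤ ∎
        where
        c₀-η≤ : ∀ u → c₀ ℚ.- η ℚ.≤ at m u
        c₀-η≤ u = subst (c₀ ℚ.- η ℚ.≤_) (solve 2 (λ x e → (x :+ e) :- e := x) refl (at m u) η)
          (ℚ.+-monoˡ-≤ (ℚ.- η) (ℚ.<⇒≤ (∣p-q∣<ε⇒p<q+ε {c₀} {at m u} (proj₂ (close u)))))

theorem2 : (n : ℕ) (G : Graph n) → Connected G →
    (c : Fin n → ℝ) → (∀ u → 0ℝ <ℝ c u) →
    (κ : Fin n → ℤ) → (∀ u → 0ℤ ≤ κ u × κ u ≤ + degree G u) →
    (α G c κ ≈ℝ ∑ (λ u → c u *ℝ fromℚ ((κ u + 1ℤ) / suc (degree G u))))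
      ⇔ ((∀ u → κ u ≡ + degree G u)
         ⊎ (IsClique G × (∀ u v → c u ≈ℝ c v) × (∀ u v → κ u ≡ κ v)))
theorem2 n G connected c 0<c κ 0≤κ≤d = mk⇔
  (λ α≈ → case stable⇒structure G c 0<c κ k κ≡+k k≤d connected (eventually-stable G c 0<c κ k κ≡+k k≤d α≈) of λ where
    (inj₁ k≡d)                → inj₁ λ u → trans (κ≡+k u) (cong +_ (k≡d u))
    (inj₂ (clique , c≈ , k≡)) → inj₂ (clique , c≈ , λ u v → trans (κ≡+k u) (trans (cong +_ (k≡ u v)) (sym (κ≡+k v)))))
  (λ structure → α≈target G c 0<c κ k κ≡+k k≤d (case structure of λ where
    (inj₁ κ≡d)                → full⇒tight G c 0<c κ k κ≡+k k≤d λ u → cong ℤ.∣_∣ (κ≡d u)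
    (inj₂ (clique , c≈ , κ≡)) → case Fin.any? {n} (λ _ → yes tt) of λ where
      (yes (u₀ , _)) → clique⇒tight G c 0<c κ k κ≡+k k≤d u₀ clique c≈ (λ u v → cong ℤ.∣_∣ (κ≡ u v))
      -- An empty graph has no reference vertex, but satisfies alternative (i) vacuously.
      (no empty)     → full⇒tight G c 0<c κ k κ≡+k k≤d λ u → contradiction (u , tt) empty))
  where
  k : Fin n → ℕ
  k u = ℤ.∣ κ u ∣
  κ≡+k : ∀ u → κ u ≡ + k u
  κ≡+k u = sym (ℤ.0≤i⇒+∣i∣≡i (proj₁ (0≤κ≤d u)))
  k≤d : ∀ u → k u ℕ.≤ degree G u
  k≤d u = ℤ.drop‿+≤+ (subst (_≤ + degree G u) (κ≡+k u) (proj₂ (0≤κ≤d u)))
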